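{- For every uniformity $r \ge 2$ and every residue class $k \not\equiv 0 \pmod r$ such that $r/\gcd(r,k)$ is odd, there is an integer $L$ such that for every $\ell > L$ with $\ell \equiv k \pmod r$, we have $\gamma(\mathcal{C}_\ell^r) \le 1/3$.
   Context: An $r$-graph is an $r$-uniform hypergraph. For $\ell > r \ge 2$, the tight $r$-uniform cycle $\mathcal{C}_\ell^r$ of length $\ell$ is the $r$-graph with vertex set $\{0,1,\ldots,\ell-1\}$ and edge set $\{\{i,i+1,\ldots,i+r-1\} : 0 \le i < \ell\}$, with addition modulo $\ell$. For an $r$-graph $\mathcal{H}$, its minimum codegree $\delta_{r-1}(\mathcal{H})$ is the minimum, over all $(r-1)$-subsets $S$ of vertices, of the number of edges containing $S$. For a family $\mathcal{F}$ of $r$-graphs, $\mathrm{ex}_{r-1}(n,\mathcal{F})$ is the maximum of $\delta_{r-1}(\mathcal{H})$ over all $n$-vertex $r$-graphs $\mathcal{H}$ containing no member of $\mathcal{F}$ as a subgraph, and the codegree Turán density is $\gamma(\mathcal{F}) = \lim_{n\to\infty} \mathrm{ex}_{r-1}(n,\mathcal{F})/n$ (this limit exists); $\gamma(\mathcal{H}) := \gamma(\{\mathcal{H}\})$. -}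

module Defs where

open import Data.Nat using (ℕ; zero; suc; _+_; _*_; _%_; _/_; _≤_; ≢-nonZero)
open import Data.Nat.GCD using (gcd; gcd[m,n]≢0)
open import Data.Nat.DivMod using (_mod_)
open import Data.Bool using (Bool; true; false; _∧_; _∨_; not)
open import Data.Bool.Properties using () renaming (_≟_ to _≟ᵇ_)
open import Data.Fin using (Fin; toℕ; _≟_)
open import Data.Fin.Subset using (Subset; ∣_∣; _∪_; ⁅_⁆)
open import Data.Vec using (Vec; lookup; tabulate)
open import Data.Vec.Properties using (≡-dec)
open import Data.Product using (Σ; ∃; _×_; _,_)
open import Data.Sum using (inj₁)
open import Function.Definitions using (Injective)
open import Relation.Binary.PropositionalEquality using (_≡_)
open import Relation.Nullary.Decidable using (⌊_⌋)

anyFin : {m : ℕ} → (Fin m → Bool) → Bool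
anyFin {zero}  f = false
anyFin {suc m} f = f Fin.zero ∨ anyFin (λ i → f (Fin.suc i))
  where import Data.Fin as Fin

record Hypergraph (n : ℕ) : Set where
  field
    edge : Subset n → Bool

open Hypergraph public

Uniform : {n : ℕ} → ℕ → Hypergraph n → Set
Uniform {n} r H = (e : Subset n) → edge H e ≡ true → ∣ e ∣ ≡ r

image : {m n : ℕ} → (Fin m → Fin n) → Subset m → Subset n
image φ e = tabulate (λ v → anyFin (λ u → lookup e u ∧ ⌊ φ u ≟ v ⌋))

Contains : {n m : ℕ} → Hypergraph n → Hypergraph m → Set
Contains {n} {m} H F =
  Σ (Fin m → Fin n) λ φ → Injective _≡_ _≡_ φ ×
    ((e : Subset m) → edge F e ≡ true → edge H (image φ e) ≡ true)

cycShift : (ℓ r : ℕ) → Fin ℓ → Fin r → Fin ℓ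
cycShift (suc ℓ) r i j = (toℕ i + toℕ j) mod (suc ℓ)

cycWindow : (ℓ r : ℕ) → Fin ℓ → Subset ℓ
cycWindow ℓ r i = tabulate (λ v → anyFin (λ j → ⌊ cycShift ℓ r i j ≟ v ⌋))

TightCycle : (r ℓ : ℕ) → Hypergraph ℓ
TightCycle r ℓ = record { edge = λ e → anyFin (λ i → ⌊ ≡-dec _≟ᵇ_ (cycWindow ℓ r i) e ⌋) }

codeg : {n : ℕ} → Hypergraph n → Subset n → ℕ
codeg H S = ∣ tabulate (λ v → not (lookup S v) ∧ edge H (S ∪ ⁅ v ⁆)) ∣

-- δ_{r-1}(H) ≤ x  (for n ≥ r - 1): some (r-1)-set has codegree ≤ x.
-- Stated in scaled form: δ_{r-1}(H) * a ≤ b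
MinCodegScaledLe : {n : ℕ} → (r : ℕ) → Hypergraph n → (a b : ℕ) → Set
MinCodegScaledLe {n} r H a b =
  Σ (Subset n) λ S → (∣ S ∣ + 1 ≡ r) × (codeg H S * a ≤ b)

-- γ(F) ≤ 1/3 for an r-graph F on m vertices: for every ε = 1/t > 0 there is N
-- such that every F-free r-graph H on n ≥ N vertices has δ_{r-1}(H) ≤ (1/3 + 1/t) n,
-- i.e. 3 t δ_{r-1}(H) ≤ (t + 3) n.
CodegDensityAtMostThird : {m : ℕ} → (r : ℕ) → Hypergraph m → Set
CodegDensityAtMostThird r F =
  (t : ℕ) → 1 ≤ t → ∃ λ N → (n : ℕ) → N ≤ n → (H : Hypergraph n) →
    Uniform r H → (Contains H F → Data.Empty.⊥) →
    MinCodegScaledLe r H (3 * t) ((t + 3) * n)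
  where import Data.Empty

-- a mod r (for r ≥ 1; r = 0 unused)
modℕ : ℕ → ℕ → ℕ
modℕ a zero    = a
modℕ a (suc r) = a % suc r

-- r / gcd(r, k)  (for r ≥ 1; r = 0 unused)
ratioGcd : ℕ → ℕ → ℕ
ratioGcd zero    k = zero
ratioGcd (suc r) k =
  _/_ (suc r) (gcd (suc r) k) {{≢-nonZero (gcd[m,n]≢0 (suc r) k (inj₁ (λ ())))}}

{-# OPTIONS --safe #-}
module Submission where

-- Write an ordered edge as a list of its r vertices, and let two ordered edges be connected when one is
-- reached from the other by replacing one vertex at a time, all intermediate lists being edges.  Running
-- through the positions cyclically turns such a chain into a tight walk, so a chain from f to the rotation
-- of f by k positions yields closed tight walks of every large length ≡ k (mod r).
--
-- Codegree > n/3 makes two of any three (r-1)-sets share a neighbour.  If e - u and e - v do, then u and v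
-- can be exchanged inside e.  Hence exchangeability splits every edge into at most two classes; whether the
-- two vertices completing an (r-2)-set R are separated depends only on R, which gives c(R) ∈ 𝔽₂ with
-- c(uR) + c(vR) + c(wR) = 0 for every edge uvwR.  From an edge with class sizes (a, b), b ≥ 2, one finds an
-- edge with sizes (a + 2, b - 2) or (r, 0).  As q = r / gcd(r, k) is odd, this reaches an edge with q ∣ b,
-- whose vertices can be arranged so that the pattern of classes is invariant under rotation by k; the
-- rotation is then a product of exchanges inside the classes.
--
-- All this takes place among a number M(r) of vertices, each picked from a positive proportion of all
-- vertices.  So a positive proportion of M-tuples contains a closed walk of one and the same shape, and
-- Erdős's box argument blows it up to an honest tight cycle.

open import Defs
open import Data.Nat using (ℕ; zero; suc; _+_; _*_; _^_; _∸_; _%_; _/_; _≤_; _<_; _≤ᵇ_; _≤?_; _<?_; z≤n; s≤s; NonZero; ≢-nonZero; >-nonZero)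
import Data.Nat as ℕ
open import Data.Nat.Properties hiding (even≢odd; _≟_)
open import Data.Nat.DivMod using (m%n<n; m<n⇒m%n≡m; [m+n]%n≡m%n; m≡m%n+[m/n]*n; m*n/n≡m; m/n*n≡m; /-monoˡ-≤)
open import Data.Nat.Divisibility using (_∣_; divides; _∣0; ∣-refl; %-presˡ-∣)
open import Data.Nat.GCD using (gcd; gcd[m,n]∣m; gcd[m,n]∣n; gcd[m,n]≢0)
import Data.Nat.ListAction as ListAction
open import Data.Nat.ListAction.Properties using (sum-↭)
open import Data.Nat.Solver using (module +-*-Solver)
open import Data.Bool using (Bool; true; false; _∧_; _∨_; _xor_; not; T)
import Data.Bool.Properties as Boolₚ
open import Data.Fin using (Fin; toℕ; fromℕ<) renaming (zero to fzero; suc to fsuc; _≟_ to _≟ᶠ_)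
open import Data.Fin.Properties using (toℕ<n; toℕ-injective; toℕ-fromℕ<)
open import Data.Fin.Subset using (Subset; ∣_∣; _∪_; ⁅_⁆) renaming (⊥ to ∅; _∈_ to _∈ˢ_; _∉_ to _∉ˢ_)
open import Data.Fin.Subset.Properties using (∪-comm; ∪-assoc; ∪-identityˡ; x∈⁅x⁆; x∈⁅y⁆⇒x≡y; x∈p∪q⁺; x∈p∪q⁻; ∉⊥; ∣⊥∣≡0; ⊆-antisym; anySubset?)
open import Data.Vec using (lookup; tabulate; _∷_; here; there)
open import Data.Vec.Properties using (lookup⇒[]=; []=⇒lookup; lookup∘tabulate) renaming (≡-dec to Vec-≡-dec)
open import Data.List using (List; []; _∷_; _++_; length; map; foldr; filter; concat; replicate; take; drop; applyUpTo; upTo; allFin; cartesianProduct; cartesianProductWith)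
import Data.List as List
open import Data.List.Properties using (++-assoc; ++-identityʳ; map-++; length-++; length-map; length-take; length-replicate; ∷-injective; filter-reject; filter-all; take++drop≡id; map-cong-local; ≡-dec)
open import Data.List.Membership.Propositional using (_∈_; _∉_; lose; find)
open import Data.List.Membership.Propositional.Properties using (∈-∃++; ∈-map⁺; ∈-map⁻; ∈-++⁺ˡ; ∈-++⁺ʳ; ∈-applyUpTo⁺; ∈-applyUpTo⁻; ∈-upTo⁺; ∈-cartesianProduct⁺; ∈-cartesianProductWith⁺; ∈-cartesianProductWith⁻)
open import Data.List.Relation.Unary.Any using (Any; here; there; any?)
import Data.List.Relation.Unary.Any as Any
open import Data.List.Relation.Unary.All using (All; []; _∷_; all?)
import Data.List.Relation.Unary.All as All
import Data.List.Relation.Unary.All.Properties as Allₚ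
open import Data.List.Relation.Unary.AllPairs using ([]; _∷_; allPairs?)
open import Data.List.Relation.Unary.Unique.Propositional using (Unique)
import Data.List.Relation.Unary.Unique.Propositional.Properties as Uniqueₚ
open import Data.List.Relation.Binary.Pointwise using (Pointwise; []; _∷_; Pointwise-length)
open import Data.List.Relation.Binary.Permutation.Propositional using (_↭_; refl; prep; swap; trans; ↭-sym; ↭-reflexive)
open import Data.List.Relation.Binary.Permutation.Propositional.Properties using (All-resp-↭; ∈-resp-↭; drop-∷; ↭-length; shift; filter-↭; map⁺; ↭-empty-inv; ++-comm; ++⁺ˡ)
open import Data.List.Relation.Binary.Sublist.Propositional using (_⊆_; []; _∷_; _∷ʳ_; ⊆-trans)
import Data.List.Relation.Binary.Sublist.Propositional.Properties as Subₚ
open import Data.Product using (Σ; ∃; _×_; _,_; proj₁; proj₂)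
open import Data.Sum using (_⊎_; inj₁; inj₂; [_,_]′)
open import Data.Empty using (⊥; ⊥-elim)
open import Data.Unit using (⊤; tt)
open import Function using (_∘_; id)
open import Relation.Binary.Definitions using (DecidableEquality)
open import Relation.Binary.Construct.Closure.ReflexiveTransitive using (Star; ε; _◅_; _◅◅_; gmap; reverse)
open import Relation.Binary.PropositionalEquality as ≡ using (_≡_; _≢_; refl; sym; cong; cong₂; subst; subst₂; module ≡-Reasoning)
open import Relation.Nullary using (¬_; Dec; yes; no; does)
open import Relation.Nullary.Decidable using (¬?; _×-dec_; dec-true; dec-false; ⌊_⌋; ¬¬-excluded-middle; decidable-stable; map′; isYes≗does)
open import Algebra.Properties.CommutativeMonoid.Sum +-0-commutativeMonoid using (sum; ∑-distrib-+)

-- A closed walk may repeat vertices and a cycle may not, so a single walk in `H` is worthless; what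
-- survives a blow-up is a walk shape present in a positive proportion of bounded tuples. This
-- dictates the form of the combinatorial part: the codegree condition enters it only through the
-- finite property `Closed`, and the number of vertices involved may depend on r alone. It does,
-- since b is at most r and drops by two, or to zero, in each step, and a step costs two rounds of
-- new vertices. One more unit of the chain supplies the first edge, and a last round supplies the
-- vertices through which the exchanges pass. Exchangeability is the existence of a path and is
-- never decided. The finitely many instances of excluded middle are taken under a double negation,
-- which disappears again because the cyclic words of given length over a finite vertex list can be
-- searched.

-- Counting over finite index sets

bit : Bool → ℕ
bit true  = 1
bit false = 0

count : ∀ {n} → (Fin n → Bool) → ℕ
count A = sum (λ z → bit (A z))

sum-mono : ∀ {n} {f g : Fin n → ℕ} → (∀ z → f z ≤ g z) → sum f ≤ sum g
sum-mono {zero}  h = z≤n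
sum-mono {suc n} h = +-mono-≤ (h fzero) (sum-mono (λ z → h (fsuc z)))

sum-const : ∀ n k → sum {n} (λ _ → k) ≡ n * k
sum-const zero    k = refl
sum-const (suc n) k = cong (k +_) (sum-const n k)

sum-*ˡ : ∀ {n} k (f : Fin n → ℕ) → sum (λ z → k * f z) ≡ k * sum f
sum-*ˡ {zero}  k f = sym (*-zeroʳ k)
sum-*ˡ {suc n} k f = ≡.trans (cong (k * f fzero +_) (sum-*ˡ k (f ∘ fsuc)))
                           (sym (*-distribˡ-+ k (f fzero) _))

count-positive : ∀ {n} (A : Fin n → Bool) → 1 ≤ count A → ∃ λ z → A z ≡ true
count-positive {suc n} A h with A fzero in eq
... | true  = fzero , eq
... | false with count-positive (A ∘ fsuc) h
...   | z , p = fsuc z , p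

module _ {X : Set} (f : X → Bool) where

  private
    consIf : ∀ i b → f i ≡ b → List (Σ X λ i → f i ≡ true) → List (Σ X λ i → f i ≡ true)
    consIf i true  eq J = (i , eq) ∷ J
    consIf i false eq J = J

    consIf-⊆ : ∀ i b (eq : f i ≡ b) {J I} → map proj₁ J ⊆ I → map proj₁ (consIf i b eq J) ⊆ i ∷ I
    consIf-⊆ i true  eq p = refl ∷ p
    consIf-⊆ i false eq p = i ∷ʳ p

    length-consIf : ∀ i b (eq : f i ≡ b) J → length (consIf i b eq J) ≡ bit b + length J
    length-consIf i true  eq J = refl
    length-consIf i false eq J = refl

  -- The proof of `f i ≡ true` stays with the index because the data attached to `i`, such as the
  -- ampleness of a fibre, is available only where the test succeeds.
  collect : List X → List (Σ X λ i → f i ≡ true)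
  collect []      = []
  collect (i ∷ I) = consIf i (f i) refl (collect I)

  collect-⊆ : ∀ I → map proj₁ (collect I) ⊆ I
  collect-⊆ []      = []
  collect-⊆ (i ∷ I) = consIf-⊆ i (f i) refl (collect-⊆ I)

  length-collect-∷ : ∀ i I → length (collect (i ∷ I)) ≡ bit (f i) + length (collect I)
  length-collect-∷ i I = length-consIf i (f i) refl (collect I)

  length-collect-≤ : ∀ I → length (collect I) ≤ length I
  length-collect-≤ I = ≤-trans (≤-reflexive (sym (length-map proj₁ (collect I)))) (Subₚ.length-mono-≤ (collect-⊆ I))

count-collect : ∀ {m} {Y : Set} (g : Fin m → Y) (f : Y → Bool) →
                length (collect f (List.tabulate g)) ≡ count (λ z → f (g z))
count-collect {zero}  g f = refl
count-collect {suc m} g f = ≡.trans (length-collect-∷ f (g fzero) (List.tabulate (g ∘ fsuc))) (cong (bit (f (g fzero)) +_) (count-collect (g ∘ fsuc) f))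

double-count : ∀ {X : Set} {n} k C (A : X → Fin n → Bool) (I : List X) → (∀ i → k ≤ C * count (A i)) →
               length I * k ≤ C * sum (λ z → length (collect (λ i → A i z) I))
double-count k C A [] h = z≤n
double-count {n = n} k C A (i ∷ I) h = begin
  k + length I * k                                   ≤⟨ +-mono-≤ (h i) (double-count k C A I h) ⟩
  C * count (A i) + C * sum (λ z → B I z)            ≡⟨ sym (*-distribˡ-+ C (count (A i)) _) ⟩
  C * (count (A i) + sum (λ z → B I z))              ≡⟨ cong (C *_) (sym (∑-distrib-+ {n} _ _)) ⟩
  C * sum (λ z → bit (A i z) + B I z)                ≤⟨ *-monoʳ-≤ C (sum-mono (λ z → ≤-reflexive (sym (length-collect-∷ (λ j → A j z) i I)))) ⟩
  C * sum (λ z → B (i ∷ I) z)                        ∎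
  where
  open ≤-Reasoning
  B : List _ → Fin n → ℕ
  B J z = length (collect (λ j → A j z) J)

sublists : {X : Set} → List X → List (List X)
sublists []      = [] ∷ []
sublists (x ∷ I) = map (x ∷_) (sublists I) ++ sublists I

⊆⇒∈sublists : ∀ {X : Set} {J I : List X} → J ⊆ I → J ∈ sublists I
⊆⇒∈sublists []         = here refl
⊆⇒∈sublists {I = x ∷ I} (_ ∷ʳ p)  = ∈-++⁺ʳ (map (x ∷_) (sublists I)) (⊆⇒∈sublists p)
⊆⇒∈sublists (refl ∷ p) = ∈-++⁺ˡ (∈-map⁺ _ (⊆⇒∈sublists p))

length-sublists : ∀ {X : Set} (I : List X) → length (sublists I) ≡ 2 ^ length I
length-sublists []      = refl
length-sublists (x ∷ I) = begin
  length (map (x ∷_) (sublists I) ++ sublists I)         ≡⟨ length-++ (map (x ∷_) (sublists I)) ⟩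
  length (map (x ∷_) (sublists I)) + length (sublists I) ≡⟨ cong (_+ length (sublists I)) (length-map (x ∷_) (sublists I)) ⟩
  length (sublists I) + length (sublists I)              ≡⟨ cong₂ _+_ (length-sublists I) (≡.trans (length-sublists I) (sym (+-identityʳ _))) ⟩
  2 ^ length I + (2 ^ length I + 0)                      ∎
  where open ≡-Reasoning

positiveʳ : ∀ {n} C {k} → 1 ≤ n → n ≤ C * k → 1 ≤ k
positiveʳ C {zero}  1≤n h = ⊥-elim (<-irrefl refl (≤-trans 1≤n (≤-trans h (≤-reflexive (*-zeroʳ C)))))
positiveʳ C {suc k} 1≤n h = s≤s z≤n

-- Density, and blowing up

-- The predicate need not be decidable: a Boolean set inside it is counted instead. The constant
-- bounds the inverse of the density, which keeps the arithmetic in ℕ.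
Many : ∀ {n} → ℕ → (Fin n → Set) → Set
Many {n} C P = Σ (Fin n → Bool) λ A → (n ≤ C * count A) × (∀ z → A z ≡ true → P z)

Many-map : ∀ {n} C {P Q : Fin n → Set} → (∀ z → P z → Q z) → Many C P → Many C Q
Many-map C f (A , big , h) = A , big , λ z p → f z (h z p)

Many-weaken : ∀ {n C C′} {P : Fin n → Set} → C ≤ C′ → Many C P → Many C′ P
Many-weaken le (A , big , h) = A , ≤-trans big (*-monoˡ-≤ (count A) le) , h

private
  split-at : ∀ {P Q : Set} b → (b ≡ true → P ⊎ Q) →
             Σ Bool λ b₁ → Σ Bool λ b₂ → (bit b ≤ bit b₁ + bit b₂) × (b₁ ≡ true → P) × (b₂ ≡ true → Q)
  split-at false h = false , false , z≤n , (λ ()) , (λ ())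
  split-at true  h with h refl
  ... | inj₁ p = true , false , s≤s z≤n , (λ _ → p) , (λ ())
  ... | inj₂ q = false , true , s≤s z≤n , (λ ()) , (λ _ → q)

  a≤a₁+a₂ : ∀ {a a₁ a₂} → a ≤ a₁ + a₂ → (a ≤ 2 * a₁) ⊎ (a ≤ 2 * a₂)
  a≤a₁+a₂ {a} {a₁} {a₂} h with ≤-total a₁ a₂
  ... | inj₁ le = inj₂ (≤-trans h (+-mono-≤ le (≤-reflexive (sym (+-identityʳ a₂)))))
  ... | inj₂ le = inj₁ (≤-trans h (+-monoʳ-≤ a₁ (≤-trans le (≤-reflexive (sym (+-identityʳ a₁))))))

-- The first index takes the points whose given witness stands at the head; either these make up
-- half of `A`, or the remaining indices share the other half. Halving once per index costs
-- `2 ^ length Φ`, cruder than `length Φ` but enough. Nonemptiness of `A` excludes the empty list.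
pigeonhole-any : ∀ {n} {X : Set} (Q : X → Fin n → Set) (Φ : List X) (A : Fin n → Bool) → 1 ≤ count A →
                 (∀ z → A z ≡ true → Any (λ i → Q i z) Φ) →
                 Any (λ i → Σ (Fin n → Bool) λ B → (count A ≤ 2 ^ length Φ * count B) × (∀ z → B z ≡ true → Q i z)) Φ
pigeonhole-any Q [] A pos h with count-positive A pos
... | z , p with h z p
... | ()
pigeonhole-any {n} Q (i ∷ Φ) A pos h = [ (λ le → here (A₁ , ≤-trans le (*-monoˡ-≤ (count A₁) 2≤) , h₁)) , recurse ]′ (a≤a₁+a₂ {a₂ = count A₂} split)
  where
  s : ∀ z → Σ Bool λ b₁ → Σ Bool λ b₂ → (bit (A z) ≤ bit b₁ + bit b₂) × (b₁ ≡ true → Q i z) × (b₂ ≡ true → Any (λ j → Q j z) Φ)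
  s z = split-at (A z) (λ p → uncons (h z p))
    where
    uncons : Any (λ j → Q j z) (i ∷ Φ) → Q i z ⊎ Any (λ j → Q j z) Φ
    uncons (here q)  = inj₁ q
    uncons (there q) = inj₂ q
  A₁ A₂ : Fin n → Bool
  A₁ z = proj₁ (s z)
  A₂ z = proj₁ (proj₂ (s z))
  h₁ : ∀ z → A₁ z ≡ true → Q i z
  h₁ z = proj₁ (proj₂ (proj₂ (proj₂ (s z))))
  split : count A ≤ count A₁ + count A₂
  split = ≤-trans (sum-mono (λ z → proj₁ (proj₂ (proj₂ (s z))))) (≤-reflexive (∑-distrib-+ {n} _ _))
  2≤ : 2 ≤ 2 ^ suc (length Φ)
  2≤ = *-monoʳ-≤ 2 (m^n>0 2 (length Φ))
  recurse : count A ≤ 2 * count A₂ → Any _ (i ∷ Φ)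
  recurse le = there (Any.map (λ { (B , big , hB) → B , ≤-trans le (≤-trans (*-monoʳ-≤ 2 big) (≤-reflexive (sym (*-assoc 2 (2 ^ length Φ) _)))) , hB })
                 (pigeonhole-any Q Φ A₂ pos₂ (λ z → proj₂ (proj₂ (proj₂ (proj₂ (s z)))))))
    where
    pos₂ : 1 ≤ count A₂
    pos₂ = positiveʳ 2 pos le

Many-any : ∀ {n C} {X : Set} (Q : X → Fin n → Set) (Φ : List X) → 1 ≤ n →
           Many C (λ z → Any (λ i → Q i z) Φ) → Any (λ i → Many (C * 2 ^ length Φ) (Q i)) Φ
Many-any {n} {C} Q Φ 1≤n (A , big , h) =
  Any.map (λ { (B , le , hB) → B , ≤-trans big (≤-trans (*-monoʳ-≤ C le) (≤-reflexive (sym (*-assoc C _ (count B))))) , hB })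
          (pigeonhole-any Q Φ A (positiveʳ C 1≤n big) h)

-- The coordinates are chosen one after the other, each from at least n/C values that may depend on the previous ones.
Ample : ∀ {n} → ℕ → ℕ → (List (Fin n) → Set) → Set
Ample C zero    P = P []
Ample C (suc m) P = Many C (λ z → Ample C m (λ l → P (z ∷ l)))

Ample-map : ∀ {n C} m {P Q : List (Fin n) → Set} → (∀ l → length l ≡ m → P l → Q l) → Ample C m P → Ample C m Q
Ample-map zero    f p = f [] refl p
Ample-map {C = C} (suc m) f p = Many-map C (λ z → Ample-map m (λ l eq → f (z ∷ l) (cong suc eq))) p

Ample-weaken : ∀ {n C C′} m {P : List (Fin n) → Set} → C ≤ C′ → Ample C m P → Ample C′ m P
Ample-weaken zero    le p = p
Ample-weaken {C = C} (suc m) le p = Many-weaken {C = C} le (Many-map C (λ z → Ample-weaken m le) p)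

Ample-bind : ∀ {n C} m m′ {P Q : List (Fin n) → Set} → Ample C m P →
             (∀ l → length l ≡ m → P l → Ample C m′ (λ l′ → Q (l ++ l′))) → Ample C (m + m′) Q
Ample-bind zero    m′ p f = f [] refl p
Ample-bind {C = C} (suc m) m′ p f = Many-map C (λ z q → Ample-bind m m′ q (λ l eq → f (z ∷ l) (cong suc eq))) p

-- A finite colouring of the tuples: inner coordinates are made monochromatic first, after which the
-- outer coordinate carries a colouring by the same indices.
Ample-any : ∀ {n C} m {X : Set} (Q : X → List (Fin n) → Set) (Φ : List X) → 1 ≤ n →
            Ample C m (λ l → Any (λ i → Q i l) Φ) → Any (λ i → Ample (C * 2 ^ length Φ) m (Q i)) Φ
Ample-any zero    Q Φ 1≤n p = p
Ample-any {C = C} (suc m) Q Φ 1≤n p =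
  Many-any {C = C} _ Φ 1≤n (Many-map C (λ z → Ample-any m (λ i l → Q i (z ∷ l)) Φ 1≤n) p)

private
  -- With this `K`, points of low multiplicity carry at most half of the guaranteed incidences; the
  -- others carry at most `K` each, which forces n / (2 (C + 1)) of them.
  threshold : ∀ {n C k K} g → (2 * suc C * suc k) * n ≤ suc C * (n * suc k + K * g) → K ≡ 2 * suc C * suc k →
              n ≤ (2 * suc C) * g
  threshold {n} {C} {k} {K} g h refl = *-cancelˡ-≤ (suc C * suc k) (+-cancelˡ-≤ (suc C * (n * suc k)) _ _ (begin
    suc C * (n * suc k) + suc C * suc k * n  ≡⟨ lhs (suc C) (suc k) n ⟩
    (2 * suc C * suc k) * n                  ≤⟨ h ⟩
    suc C * (n * suc k + K * g)              ≡⟨ rhs (suc C) (suc k) n g ⟩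
    suc C * (n * suc k) + suc C * suc k * ((2 * suc C) * g) ∎))
    where
    open ≤-Reasoning
    open +-*-Solver
    lhs : ∀ c d e → c * (e * d) + c * d * e ≡ (2 * c * d) * e
    lhs = solve 3 (λ c d e → c :* (e :* d) :+ c :* d :* e := (con 2 :* c :* d) :* e) refl
    rhs : ∀ c d e f → c * (e * d + (2 * c * d) * f) ≡ c * (e * d) + c * d * ((2 * c) * f)
    rhs = solve 4 (λ c d e f → c :* (e :* d :+ (con 2 :* c :* d) :* f) := c :* (e :* d) :+ c :* d :* ((con 2 :* c) :* f)) refl

-- Double counting: many z lie in at least k + 1 of the first-coordinate sets, for each of them the induction
-- hypothesis selects a family of s indices, and one family serves for many z.
Ample-intersection : ∀ C m s → ∃ λ K → ∃ λ C′ → ∀ {n} {X : Set} (P : X → List (Fin n) → Set) → 1 ≤ n →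
  (∀ i → Ample (suc C) m (P i)) → (I : List X) → K ≤ length I →
  ∃ λ J → (J ⊆ I) × (length J ≡ s) × Ample C′ m (λ l → All (λ i → P i l) J)
Ample-intersection C zero s = s , 0 , λ P 1≤n amp I le →
  take s I , Subₚ.take-⊆ s I , ≡.trans (length-take s I) (m≤n⇒m⊓n≡m le) , All.universal amp (take s I)
Ample-intersection C (suc m) s with Ample-intersection C m s
... | k , C₁ , ih = K , C′ , main
  where
  K C₂ C′ : ℕ
  K  = 2 * suc C * suc k
  C₂ = (2 * suc C) * 2 ^ (2 ^ K)
  C′ = C₂ + C₁
  main : ∀ {n} {X : Set} (P : X → List (Fin n) → Set) → 1 ≤ n →
    (∀ i → Ample (suc C) (suc m) (P i)) → (I : List X) → K ≤ length I →
    ∃ λ J → (J ⊆ I) × (length J ≡ s) × Ample C′ (suc m) (λ l → All (λ i → P i l) J)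
  main {n} {X} P 1≤n amp I le = finish (Many-any {C = 2 * suc C} Q (sublists I₀) 1≤n (G , big , good))
    where
    -- Truncation to exactly `K` indices bounds the number of sublists, so the pigeonhole loss does
    -- not depend on the length of `I`.
    I₀ : List X
    I₀ = take K I
    length-I₀ : length I₀ ≡ K
    length-I₀ = ≡.trans (length-take K I) (m≤n⇒m⊓n≡m le)
    A : X → Fin n → Bool
    A i = proj₁ (amp i)
    B : Fin n → ℕ
    B z = length (collect (λ i → A i z) I₀)
    G : Fin n → Bool
    G z = suc k ≤ᵇ B z
    Q : List X → Fin n → Set
    Q J z = (J ⊆ I₀) × (length J ≡ s) × Ample C₁ m (λ l → All (λ i → P i (z ∷ l)) J)
    B≤ : ∀ z → B z ≤ suc k + K * bit (G z)
    B≤ z with suc k ≤ᵇ B z in eq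
    ... | true  = ≤-trans (length-collect-≤ (λ i → A i z) I₀)
                    (≤-trans (≤-reflexive (≡.trans length-I₀ (sym (*-identityʳ K)))) (m≤n+m (K * 1) (suc k)))
    ... | false = ≤-trans (<⇒≤ (≰⇒> (λ q → subst T eq (≤⇒≤ᵇ q)))) (m≤m+n (suc k) (K * 0))
    big : n ≤ (2 * suc C) * count G
    big = threshold {n} {C} {k} (count G) (begin
      K * n                                       ≡⟨ cong (_* n) (sym length-I₀) ⟩
      length I₀ * n                               ≤⟨ double-count n (suc C) A I₀ (λ i → proj₁ (proj₂ (amp i))) ⟩
      suc C * sum B                               ≤⟨ *-monoʳ-≤ (suc C) (sum-mono B≤) ⟩
      suc C * sum (λ z → suc k + K * bit (G z))   ≡⟨ cong (suc C *_) (≡.trans (∑-distrib-+ {n} _ _) (cong₂ _+_ (sum-const n (suc k)) (sum-*ˡ K (λ z → bit (G z))))) ⟩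
      suc C * (n * suc k + K * count G)           ∎) refl
      where open ≤-Reasoning
    good : ∀ z → G z ≡ true → Any (λ J → Q J z) (sublists I₀)
    good z p with ih {X = Σ X λ i → A i z ≡ true} (λ i l → P (proj₁ i) (z ∷ l)) 1≤n
                     (λ i → proj₂ (proj₂ (amp (proj₁ i))) z (proj₂ i))
                     (collect (λ i → A i z) I₀) (<⇒≤ (≤ᵇ⇒≤ (suc k) (B z) (subst T (sym p) tt)))
    ... | J , J⊆ , len , ampJ = Any.map (λ { refl → q }) (⊆⇒∈sublists (proj₁ q))
      where
      q : Q (map proj₁ J) z
      q = ⊆-trans (Subₚ.map⁺ proj₁ J⊆) (collect-⊆ (λ i → A i z) I₀) , ≡.trans (length-map proj₁ J) len ,
          Ample-map m (λ l _ → Allₚ.map⁺) ampJ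
    finish : Any (λ J → Many (2 * suc C * 2 ^ length (sublists I₀)) (Q J)) (sublists I₀) →
             ∃ λ J → (J ⊆ I) × (length J ≡ s) × Ample C′ (suc m) (λ l → All (λ i → P i l) J)
    finish found with Any.satisfied found
    ... | J , (D , bigD , hD) with count-positive D (positiveʳ (2 * suc C * 2 ^ length (sublists I₀)) 1≤n bigD)
    ... | z₀ , p₀ = J , ⊆-trans (proj₁ (hD z₀ p₀)) (Subₚ.take-⊆ K I) , proj₁ (proj₂ (hD z₀ p₀)) ,
        (D , ≤-trans bigD (*-monoˡ-≤ (count D) (≤-trans (≤-reflexive (cong (λ e → 2 * suc C * 2 ^ e) (≡.trans (length-sublists I₀) (cong (2 ^_) length-I₀)))) (m≤m+n C₂ C₁))) ,
         λ z p → Ample-weaken m (m≤n+m C₁ C₂) (proj₂ (proj₂ (hD z p))))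

-- A complete m-partite m-graph with parts of size s. The rows may overlap here; disjointness, where
-- it matters, is extracted from `P`.
Box : ∀ {n} → ℕ → ℕ → (List (Fin n) → Set) → Set
Box {n} s m P = ∃ λ (rows : List (List (Fin n))) → (length rows ≡ m) × All (λ Z → Unique Z × length Z ≡ s) rows ×
                (∀ l → Pointwise _∈_ l rows → P l)

Unique-⊆ : ∀ {X : Set} {xs ys : List X} → xs ⊆ ys → Unique ys → Unique xs
Unique-⊆ []         []       = []
Unique-⊆ (_ ∷ʳ p)   (_ ∷ u)  = Unique-⊆ p u
Unique-⊆ (refl ∷ p) (h ∷ u)  = Subₚ.All-resp-⊆ p h ∷ Unique-⊆ p u

-- `Ample-intersection` finds s first coordinates that share an ample set of tails. They form the
-- first row, and the tails are boxed recursively. The summand `suc C * K` guarantees enough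
-- candidates for the first coordinate.
Ample⇒Box : ∀ C m s → ∃ λ N → ∀ {n} (P : List (Fin n) → Set) → 1 ≤ n → N ≤ n → Ample (suc C) m P → Box s m P
Ample⇒Box C zero s = 0 , λ P _ _ p → [] , refl , [] , λ { .[] [] → p }
Ample⇒Box C (suc m) s with Ample-intersection C m s
... | K , C₁ , int with Ample⇒Box C₁ m s
... | N , box = N + suc C * K , main
  where
  main : ∀ {n} (P : List (Fin n) → Set) → 1 ≤ n → N + suc C * K ≤ n → Ample (suc C) (suc m) P → Box s (suc m) P
  main {n} P 1≤n N≤n (A , big , h)
    with int {X = Σ (Fin n) λ z → A z ≡ true} (λ i l → P (proj₁ i ∷ l)) 1≤n (λ i → h (proj₁ i) (proj₂ i))
             (collect A (allFin n)) K≤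
    where
    K≤ : K ≤ length (collect A (allFin n))
    K≤ = ≤-trans (*-cancelˡ-≤ (suc C) (≤-trans (m≤n+m (suc C * K) N) (≤-trans N≤n big)))
                 (≤-reflexive (sym (count-collect id A)))
  ... | J , J⊆ , len , ampJ
    with box (λ l → All (λ i → P (proj₁ i ∷ l)) J) 1≤n (≤-trans (m≤m+n N (suc C * K)) N≤n) (Ample-weaken m (n≤1+n C₁) ampJ)
  ... | rows , lenr , urows , hr =
    map proj₁ J ∷ rows , cong suc lenr ,
    (Unique-⊆ (⊆-trans (Subₚ.map⁺ proj₁ J⊆) (collect-⊆ A (allFin n))) (Uniqueₚ.allFin⁺ n) , ≡.trans (length-map proj₁ J) len) ∷ urows ,
    λ { (z ∷ l) (z∈ ∷ pw) → All.lookup (Allₚ.map⁺ (hr l pw)) z∈ }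

-- Permutations of lists, Boolean counts and parity

module _ {V : Set} where

  -- pₖ brings the k-th entry (counted from 0) to the front; p ◂ q fixes the first entry of the target by p.
  infixr 5 _◂_
  _◂_ : ∀ {xs xs′ ys : List V} {u} → xs ↭ u ∷ xs′ → xs′ ↭ ys → xs ↭ u ∷ ys
  p ◂ q = trans p (prep _ q)

  p₁ : ∀ {a b} {R : List V} → a ∷ b ∷ R ↭ b ∷ a ∷ R
  p₁ = swap _ _ refl

  p₂ : ∀ {a b c} {R : List V} → a ∷ b ∷ c ∷ R ↭ c ∷ a ∷ b ∷ R
  p₂ = trans (prep _ p₁) p₁

  p₃ : ∀ {a b c d} {R : List V} → a ∷ b ∷ c ∷ d ∷ R ↭ d ∷ a ∷ b ∷ c ∷ R
  p₃ = trans (prep _ p₂) p₁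

  p₄ : ∀ {a b c d e} {R : List V} → a ∷ b ∷ c ∷ d ∷ e ∷ R ↭ e ∷ a ∷ b ∷ c ∷ d ∷ R
  p₄ = trans (prep _ p₃) p₁

  Unique-resp-↭ : ∀ {xs ys : List V} → xs ↭ ys → Unique xs → Unique ys
  Unique-resp-↭ refl         u                   = u
  Unique-resp-↭ (prep x p)   (h ∷ u)             = All-resp-↭ p h ∷ Unique-resp-↭ p u
  Unique-resp-↭ (swap x y p) ((n ∷ h) ∷ h′ ∷ u)  = ((λ e → n (sym e)) ∷ All-resp-↭ p h′) ∷ All-resp-↭ p h ∷ Unique-resp-↭ p u
  Unique-resp-↭ (trans p q)  u                   = Unique-resp-↭ q (Unique-resp-↭ p u)

  ∈⇒↭ : ∀ {x} {xs : List V} → x ∈ xs → ∃ λ ys → xs ↭ x ∷ ys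
  ∈⇒↭ {x} x∈ with ∈-∃++ x∈
  ... | ys , zs , refl = ys ++ zs , shift x ys zs

  ↭⇒∈ : ∀ {x} {xs ys : List V} → xs ↭ x ∷ ys → x ∈ xs
  ↭⇒∈ p = ∈-resp-↭ (↭-sym p) (here refl)

  trues : (V → Bool) → List V → ℕ
  trues s F = ListAction.sum (map (bit ∘ s) F)

  trues-↭ : ∀ s {F G} → F ↭ G → trues s F ≡ trues s G
  trues-↭ s p = sum-↭ (map⁺ (bit ∘ s) p)

  trues-pick : ∀ s F → 1 ≤ trues s F → ∃ λ y → ∃ λ T → (F ↭ y ∷ T) × (s y ≡ true)
  trues-pick s (p ∷ F) h with s p in eq
  ... | true  = p , F , refl , eq
  ... | false with trues-pick s F h
  ...   | y , T , q , e = y , p ∷ T , trans (prep p q) p₁ , e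

  trues-cong : ∀ {s s′} F → All (λ p → s p ≡ s′ p) F → trues s F ≡ trues s′ F
  trues-cong []      []      = refl
  trues-cong (p ∷ F) (e ∷ h) = cong₂ _+_ (cong bit e) (trues-cong F h)

  trues-not : ∀ s F → trues (not ∘ s) F + trues s F ≡ length F
  trues-not s []      = refl
  trues-not s (p ∷ F) with s p
  ... | true  = ≡.trans (+-suc _ _) (cong suc (trues-not s F))
  ... | false = cong suc (trues-not s F)

  trues-false : ∀ F → trues (λ _ → false) F ≡ 0
  trues-false []      = refl
  trues-false (p ∷ F) = trues-false F

xor-solve : ∀ a b c {α β} → a xor (b xor c) ≡ false → a ≡ α → b ≡ β → c ≡ α xor β
xor-solve true  true  false _ refl refl = refl
xor-solve true  false true  _ refl refl = refl
xor-solve false true  true  _ refl refl = refl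
xor-solve false false false _ refl refl = refl

true≢false : true ≢ false
true≢false ()

x≢x-xor-true : ∀ x → x ≢ x xor true
x≢x-xor-true true  ()
x≢x-xor-true false ()

xor-cancelʳ : ∀ a b c → a xor b ≡ b xor c → a ≡ c
xor-cancelʳ true  true  true  _ = refl
xor-cancelʳ true  false true  _ = refl
xor-cancelʳ false true  false _ = refl
xor-cancelʳ false false false _ = refl

even≢odd : ∀ i j → i * 2 ≡ suc (j * 2) → ⊥
even≢odd (suc i) (suc j) eq = even≢odd i j (suc-injective (suc-injective eq))

even-or-odd : ∀ n → ∃ λ j → (n ≡ j * 2) ⊎ (n ≡ suc (j * 2))
even-or-odd zero    = 0 , inj₁ refl
even-or-odd (suc n) with even-or-odd n
... | j , inj₁ eq = j , inj₂ (cong suc eq)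
... | j , inj₂ eq = suc j , inj₁ (cong suc eq)

-- The parity argument

module Common {V : Set} (_≟_ : DecidableEquality V) (r : ℕ) (E : List V → Set) where

  Admissible : List V → List V → Set
  Admissible ws S = All (_∈ ws) S × Unique S × (suc (length S) ≡ r)

  TwoOf : V → List V → List V → List V → Set
  TwoOf z S₁ S₂ S₃ = (E (z ∷ S₁) × E (z ∷ S₂)) ⊎ (E (z ∷ S₁) × E (z ∷ S₃)) ⊎ (E (z ∷ S₂) × E (z ∷ S₃))

  TwoOf-same : ∀ {z S} → TwoOf z S S S → E (z ∷ S)
  TwoOf-same (inj₁ (e , _))        = e
  TwoOf-same (inj₂ (inj₁ (e , _))) = e
  TwoOf-same (inj₂ (inj₂ (e , _))) = e

  -- The finite trace of codegree above n/3. The three sets may coincide, and then `z` completes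
  -- that set to an edge. Freshness of `z` keeps later sets free of repetitions and places `z` on
  -- the root's side by default.
  Closed : List V → List V → Set
  Closed ws ws′ = ∀ S₁ S₂ S₃ → Admissible ws S₁ → Admissible ws S₂ → Admissible ws S₃ →
                  ∃ λ z → (z ∈ ws′) × (z ∉ ws) × TwoOf z S₁ S₂ S₃

  -- Every unit of the index allows one step of the descent, which adds vertices twice.
  data Chain (X : List V) : List V → ℕ → Set where
    stop : ∀ {ws} → (∀ {u} → u ∈ ws → u ∈ X) → Chain X ws zero
    more : ∀ {ws ws₁ ws₂ d} → Closed ws ws₁ → (∀ {u} → u ∈ ws → u ∈ ws₁) →
           Closed ws₁ ws₂ → (∀ {u} → u ∈ ws₁ → u ∈ ws₂) → Chain X ws₂ d → Chain X ws (suc d)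

  Chain⇒⊆ : ∀ {X ws d} → Chain X ws d → ∀ {u} → u ∈ ws → u ∈ X
  Chain⇒⊆ (stop h)           u∈ = h u∈
  Chain⇒⊆ (more _ f _ g ch)  u∈ = Chain⇒⊆ ch (g (f u∈))

  -- Give each pair in an edge inside `X` the value of `c` on the rest of the edge. By `cut` every
  -- triangle has sum zero, so the pairs of value 1 form a complete bipartite graph between two
  -- classes; a state records these relative to a root.
  module Parity (E-resp : ∀ {L L′} → L ↭ L′ → E L → E L′) (E-unique : ∀ {L} → E L → Unique L)
                (E-length : ∀ {L} → E L → length L ≡ r)
                (X : List V) (c : List V → Bool) (c-resp : ∀ {R R′} → R ↭ R′ → c R ≡ c R′)
                (cut : ∀ {u v w R} → E (u ∷ v ∷ w ∷ R) → All (_∈ X) (u ∷ v ∷ w ∷ R) →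
                       c (u ∷ R) xor (c (v ∷ R) xor c (w ∷ R)) ≡ false) where

    open import Data.List.Membership.DecPropositional _≟_ using (_∈?_)

    -- An edge x ∷ F in which s p tells whether p and the root x are separated.
    record State (ws : List V) (x : V) (F : List V) (s : V → Bool) : Set where
      field
        isEdge  : E (x ∷ F)
        inside  : All (_∈ ws) (x ∷ F)
        root    : s x ≡ false
        outside : ∀ {u} → u ∉ ws → s u ≡ false
        sides   : ∀ {p F′} → F ↭ p ∷ F′ → c F′ ≡ s p

    open State

    -- Both `y` and `y′` are separated from `x` in the edge x y y′ T. A fresh `x′` replaces `x`,
    -- giving x′ y y′ T, and a fresh `z` completes x x′ T to the new edge with root `z`. The old
    -- edges determine the values of `c` that place `x` and `x′`; the vertices of T need further
    -- common neighbours.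
    module Step {ws₀ ws₁ ws₂ : List V} (cl₀₁ : Closed ws₀ ws₁) (i₀₁ : ∀ {u} → u ∈ ws₀ → u ∈ ws₁)
                (cl₁₂ : Closed ws₁ ws₂) (i₁₂ : ∀ {u} → u ∈ ws₁ → u ∈ ws₂) (i₂ : ∀ {u} → u ∈ ws₂ → u ∈ X)
                {x : V} {F : List V} {s : V → Bool} (st : State ws₀ x F s)
                {y y′ : V} {T : List V} (F↭ : F ↭ y ∷ y′ ∷ T) (sy : s y ≡ true) (sy′ : s y′ ≡ true) where

      Ed : List V → Set
      Ed L = E L × All (_∈ ws₂) L

      Ed-resp : ∀ {L L′} → L ↭ L′ → Ed L → Ed L′
      Ed-resp p (e , a) = E-resp p e , All-resp-↭ p a

      cut-value : ∀ {u v w R α β L} → Ed L → L ↭ u ∷ v ∷ w ∷ R → c (u ∷ R) ≡ α → c (v ∷ R) ≡ β → c (w ∷ R) ≡ α xor β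
      cut-value {u} {v} {w} {R} ed p = xor-solve (c (u ∷ R)) (c (v ∷ R)) (c (w ∷ R))
        (cut (proj₁ (Ed-resp p ed)) (All.map i₂ (proj₂ (Ed-resp p ed))))

      tail-admissible : ∀ {ws z S L} → E L → L ↭ z ∷ S → All (_∈ ws) S → Admissible ws S
      tail-admissible e p a with E-unique (E-resp p e)
      ... | _ ∷ u = a , u , ≡.trans (sym (↭-length p)) (E-length e)

      e-edge : E (x ∷ y ∷ y′ ∷ T)
      e-edge = E-resp (prep x F↭) (isEdge st)

      e-in : All (_∈ ws₀) (x ∷ y ∷ y′ ∷ T)
      e-in = All-resp-↭ (prep x F↭) (inside st)

      e-Ed : Ed (x ∷ y ∷ y′ ∷ T)
      e-Ed = e-edge , All.map (i₁₂ ∘ i₀₁) e-in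

      private
        first-choice : ∃ λ z → (z ∈ ws₁) × (z ∉ ws₀) × TwoOf z (y ∷ y′ ∷ T) (y ∷ y′ ∷ T) (y ∷ y′ ∷ T)
        first-choice = cl₀₁ _ _ _ adm adm adm
          where
          adm : Admissible ws₀ (y ∷ y′ ∷ T)
          adm = tail-admissible e-edge refl (All.tail e-in)

      x′ : V
      x′ = proj₁ first-choice

      x′∈ : x′ ∈ ws₁
      x′∈ = proj₁ (proj₂ first-choice)

      x′∉ : x′ ∉ ws₀
      x′∉ = proj₁ (proj₂ (proj₂ first-choice))

      e′-Ed : Ed (x′ ∷ y ∷ y′ ∷ T)
      e′-Ed = TwoOf-same (proj₂ (proj₂ (proj₂ first-choice))) , i₁₂ x′∈ ∷ All.tail (proj₂ e-Ed)

      x′-admissible : ∀ {u v S} → x ∷ y ∷ y′ ∷ T ↭ u ∷ v ∷ S → Admissible ws₁ (x′ ∷ S)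
      x′-admissible p with All-resp-↭ p e-in | E-unique (E-resp p e-edge) | ≡.trans (sym (↭-length p)) (E-length e-edge)
      ... | _ ∷ _ ∷ a | _ ∷ _ ∷ u | len =
        x′∈ ∷ All.map i₀₁ a , All.map (λ { w∈ refl → x′∉ w∈ }) a ∷ u , len

      old-admissible : ∀ {u S} → x ∷ y ∷ y′ ∷ T ↭ u ∷ S → Admissible ws₁ S
      old-admissible p = tail-admissible e-edge p (All.map i₀₁ (All.tail (All-resp-↭ p e-in)))

      Admissible-resp : ∀ {ws S S′} → S ↭ S′ → Admissible ws S → Admissible ws S′
      Admissible-resp p (a , u , l) = All-resp-↭ p a , Unique-resp-↭ p u , ≡.trans (cong suc (sym (↭-length p))) l

      private
        second-choice : ∃ λ z → (z ∈ ws₂) × (z ∉ ws₁) × TwoOf z (x ∷ x′ ∷ T) (x ∷ x′ ∷ T) (x ∷ x′ ∷ T)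
        second-choice = cl₁₂ _ _ _ adm adm adm
          where
          adm : Admissible ws₁ (x ∷ x′ ∷ T)
          adm = Admissible-resp p₁ (x′-admissible (p₁ ◂ p₁ ◂ refl))

      z : V
      z = proj₁ second-choice

      z∉ : z ∉ ws₁
      z∉ = proj₁ (proj₂ (proj₂ second-choice))

      f-Ed : Ed (z ∷ x ∷ x′ ∷ T)
      f-Ed = TwoOf-same (proj₂ (proj₂ (proj₂ second-choice))) , proj₁ (proj₂ second-choice) ∷
             All.head (proj₂ e-Ed) ∷ i₁₂ x′∈ ∷ All.tail (All.tail (All.tail (proj₂ e-Ed)))

      cyT : c (y ∷ T) ≡ true
      cyT = ≡.trans (sides st (trans F↭ p₁)) sy′

      cy′T : c (y′ ∷ T) ≡ true
      cy′T = ≡.trans (sides st F↭) sy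

      -- In the old edge this is the value of the pair `y`, `y′`, which lies in one class; in `f-Ed`
      -- the same value says that `z` and `x′` are together. Likewise `cx′T` puts `x` with `z`.
      cxT : c (x ∷ T) ≡ false
      cxT = cut-value e-Ed (p₁ ◂ p₁ ◂ refl) cyT cy′T

      cx′T : c (x′ ∷ T) ≡ false
      cx′T = cut-value e′-Ed (p₁ ◂ p₁ ◂ refl) cyT cy′T

      extend : ∀ {w S} → w ∈ ws₂ → Admissible ws₁ S → E (w ∷ S) → Ed (w ∷ S)
      extend w∈ (a , _) e = e , w∈ ∷ All.map i₁₂ a

      -- Two of the sets t x x′, t x y, x x′ y (each with T′) have a common neighbour w.
      same-side : ∀ {t T′} → T ↭ t ∷ T′ → s t ≡ false → c (x ∷ x′ ∷ T′) ≡ false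
      same-side {t} {T′} T↭ st≡ = conclude (cl₁₂ _ _ _ adm₁ adm₂ adm₃)
        where
        e↭ : x ∷ y ∷ y′ ∷ T ↭ x ∷ y ∷ y′ ∷ t ∷ T′
        e↭ = prep _ (prep _ (prep _ T↭))
        e : Ed (x ∷ y ∷ y′ ∷ t ∷ T′)
        e = Ed-resp e↭ e-Ed
        S₁ S₂ S₃ : List V
        S₁ = t ∷ x ∷ x′ ∷ T′
        S₂ = t ∷ x ∷ y ∷ T′
        S₃ = x ∷ x′ ∷ y ∷ T′
        adm₁ : Admissible ws₁ S₁
        adm₁ = Admissible-resp p₂′ (x′-admissible (trans e↭ (p₁ ◂ p₁ ◂ p₁)))
          where
          p₂′ : x′ ∷ t ∷ x ∷ T′ ↭ t ∷ x ∷ x′ ∷ T′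
          p₂′ = p₁ ◂ p₁
        adm₂ : Admissible ws₁ S₂
        adm₂ = old-admissible (trans e↭ (p₂ ◂ p₂ ◂ refl))
        adm₃ : Admissible ws₁ S₃
        adm₃ = Admissible-resp p₁ (x′-admissible (trans e↭ (p₂ ◂ p₂ ◂ refl)))
        c-tx : c (t ∷ x ∷ T′) ≡ false
        c-tx = ≡.trans (c-resp (trans p₁ (prep x (↭-sym T↭)))) cxT
        c-xt : c (x ∷ t ∷ T′) ≡ false
        c-xt = ≡.trans (c-resp p₁) c-tx
        c-x′t : c (x′ ∷ t ∷ T′) ≡ false
        c-x′t = ≡.trans (c-resp (prep x′ (↭-sym T↭))) cx′T
        c-yt : c (y ∷ t ∷ T′) ≡ true
        c-yt = ≡.trans (c-resp (prep y (↭-sym T↭))) cyT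
        c-y′y : c (y′ ∷ y ∷ T′) ≡ false
        c-y′y = ≡.trans (c-resp p₁) (≡.trans (sides st (trans F↭ (trans (prep y (prep y′ T↭)) p₂))) st≡)
        c-xy : c (x ∷ y ∷ T′) ≡ true
        c-xy = cut-value e (p₃ ◂ p₂ ◂ refl) (≡.trans (c-resp p₁) c-yt) c-y′y
        c-yx : c (y ∷ x ∷ T′) ≡ true
        c-yx = ≡.trans (c-resp p₁) c-xy
        κ : Bool
        κ = c (x ∷ x′ ∷ T′)
        c-x′x : c (x′ ∷ x ∷ T′) ≡ κ
        c-x′x = c-resp p₁
        conclude : (∃ λ w → (w ∈ ws₂) × (w ∉ ws₁) × TwoOf w S₁ S₂ S₃) → κ ≡ false
        -- Edges on S₁ and S₂ give c (w t T′) both values; edges on S₁ and S₃ make c (w x T′) equal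
        -- to κ and to κ + 1. In the remaining case S₂ gives c (w x T′) = 1, and the edge on S₃ then
        -- gives κ = 1 + 1.
        conclude (w , w∈ , _ , inj₁ (e₁ , e₂)) = ⊥-elim (true≢false (≡.trans
          (sym (cut-value (extend w∈ adm₂ e₂) (p₂ ◂ p₂ ◂ refl) c-xt c-yt))
          (cut-value (extend w∈ adm₁ e₁) (p₂ ◂ p₂ ◂ refl) c-xt c-x′t)))
        conclude (w , w∈ , _ , inj₂ (inj₁ (e₁ , e₃))) = ⊥-elim (x≢x-xor-true κ (≡.trans
          (sym (cut-value (extend w∈ adm₁ e₁) (p₁ ◂ p₂ ◂ refl) c-tx c-x′x))
          (cut-value (extend w∈ adm₃ e₃) (p₂ ◂ p₂ ◂ refl) c-x′x c-yx)))
        conclude (w , w∈ , _ , inj₂ (inj₂ (e₂ , e₃))) = ≡.trans (sym c-x′x)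
          (cut-value (extend w∈ adm₃ e₃) (p₃ ◂ refl ◂ p₁) c-yx
            (cut-value (extend w∈ adm₂ e₂) (p₁ ◂ p₂ ◂ refl) c-tx c-yx))

      -- Two of the sets x u y v, x x′ u y, x x′ y v (each with T′) have a common neighbour w.
      other-side : ∀ {u v T′} → T ↭ u ∷ v ∷ T′ → s u ≡ true → s v ≡ true →
                   c (u ∷ x ∷ x′ ∷ T′) ≡ c (v ∷ x ∷ x′ ∷ T′)
      other-side {u} {v} {T′} T↭ su sv = conclude (cl₁₂ _ _ _ adm₁ adm₂ adm₃)
        where
        e↭ : x ∷ y ∷ y′ ∷ T ↭ x ∷ y ∷ y′ ∷ u ∷ v ∷ T′
        e↭ = prep _ (prep _ (prep _ T↭))
        e : Ed (x ∷ y ∷ y′ ∷ u ∷ v ∷ T′)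
        e = Ed-resp e↭ e-Ed
        e′ : Ed (x′ ∷ y ∷ y′ ∷ u ∷ v ∷ T′)
        e′ = Ed-resp (prep _ (prep _ (prep _ T↭))) e′-Ed
        F↭′ : F ↭ y ∷ y′ ∷ u ∷ v ∷ T′
        F↭′ = trans F↭ (prep y (prep y′ T↭))
        S₁ S₂ S₃ : List V
        S₁ = x ∷ u ∷ y ∷ v ∷ T′
        S₂ = x ∷ x′ ∷ u ∷ y ∷ T′
        S₃ = x ∷ x′ ∷ y ∷ v ∷ T′
        adm₁ : Admissible ws₁ S₁
        adm₁ = old-admissible (trans e↭ (p₂ ◂ refl ◂ p₁))
        adm₂ : Admissible ws₁ S₂
        adm₂ = Admissible-resp p₁ (x′-admissible (trans e↭ (p₂ ◂ p₃ ◂ refl ◂ p₁)))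
        adm₃ : Admissible ws₁ S₃
        adm₃ = Admissible-resp p₁ (x′-admissible (trans e↭ (p₂ ◂ p₂ ◂ refl)))
        c-vuy : c (v ∷ u ∷ y ∷ T′) ≡ true
        c-vuy = ≡.trans (c-resp (p₂ ◂ p₁)) (≡.trans (sides st (trans F↭′ p₁)) sy′)
        c-uyv : c (u ∷ y ∷ v ∷ T′) ≡ true
        c-uyv = ≡.trans (c-resp (p₂ ◂ refl)) c-vuy
        c-y′uy : c (y′ ∷ u ∷ y ∷ T′) ≡ true
        c-y′uy = ≡.trans (c-resp p₂) (≡.trans (sides st (trans F↭′ p₃)) sv)
        c-y′yv : c (y′ ∷ y ∷ v ∷ T′) ≡ true
        c-y′yv = ≡.trans (c-resp p₁) (≡.trans (sides st (trans F↭′ p₂)) su)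
        c-xuy : c (x ∷ u ∷ y ∷ T′) ≡ false
        c-xuy = cut-value e (p₄ ◂ p₂ ◂ refl ◂ p₁) c-vuy c-y′uy
        c-x′uy : c (x′ ∷ u ∷ y ∷ T′) ≡ false
        c-x′uy = cut-value e′ (p₄ ◂ p₂ ◂ refl ◂ p₁) c-vuy c-y′uy
        c-xyv : c (x ∷ y ∷ v ∷ T′) ≡ false
        c-xyv = cut-value e (p₃ ◂ p₂ ◂ refl) c-uyv c-y′yv
        c-x′yv : c (x′ ∷ y ∷ v ∷ T′) ≡ false
        c-x′yv = cut-value e′ (p₃ ◂ p₂ ◂ refl) c-uyv c-y′yv
        h : V → Bool
        h p = c (p ∷ x ∷ x′ ∷ T′)
        conclude : (∃ λ w → (w ∈ ws₂) × (w ∉ ws₁) × TwoOf w S₁ S₂ S₃) → h u ≡ h v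
        conclude (w , w∈ , _ , inj₁ (e₁ , e₂)) = ⊥-elim (true≢false (≡.trans
          (sym (cut-value (extend w∈ adm₁ e₁) (p₁ ◂ p₃ ◂ refl) c-xuy c-vuy))
          (cut-value (extend w∈ adm₂ e₂) (p₁ ◂ p₁ ◂ refl) c-xuy c-x′uy)))
        conclude (w , w∈ , _ , inj₂ (inj₁ (e₁ , e₃))) = ⊥-elim (true≢false (≡.trans
          (sym (cut-value (extend w∈ adm₁ e₁) (p₁ ◂ p₁ ◂ refl) c-xyv c-uyv))
          (cut-value (extend w∈ adm₃ e₃) (p₁ ◂ p₁ ◂ refl) c-xyv c-x′yv)))
        -- The edges on S₂ and S₃ both compute c (w x x′ T′), as h u + h y and as h y + h v; the
        -- unknown h y cancels.
        conclude (w , w∈ , _ , inj₂ (inj₂ (e₂ , e₃))) = xor-cancelʳ (h u) (h y) (h v) (≡.trans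
          (sym (cut-value (extend w∈ adm₂ e₂) (p₃ ◂ p₃ ◂ refl) refl refl))
          (cut-value (extend w∈ adm₃ e₃) (p₃ ◂ p₃ ◂ refl) refl refl))

      other-side-const : ∀ {u v T₁ T₂} → T ↭ u ∷ T₁ → T ↭ v ∷ T₂ → s u ≡ true → s v ≡ true →
                         c (x ∷ x′ ∷ T₁) ≡ c (x ∷ x′ ∷ T₂)
      other-side-const {u} {v} {T₁} {T₂} pu pv su sv with ∈-resp-↭ pu (↭⇒∈ pv)
      ... | here refl = c-resp (prep x (prep x′ (drop-∷ (trans (↭-sym pu) pv))))
      ... | there v∈ with ∈⇒↭ v∈
      ...   | T₃ , q = ≡.trans (c-resp (trans (prep x (prep x′ q)) p₂))
                       (≡.trans (sym (other-side (trans pu (prep u q)) su sv))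
                                (c-resp (trans (p₁ ◂ p₁) (prep x (prep x′ (↭-sym T₂↭))))))
        where
        T₂↭ : T₂ ↭ u ∷ T₃
        T₂↭ = drop-∷ (trans (↭-sym pv) (trans pu (trans (prep u q) p₁)))

      Common-side : Bool → Set
      Common-side κ = ∀ {p T′} → T ↭ p ∷ T′ → s p ≡ true → c (x ∷ x′ ∷ T′) ≡ κ

      common-side : ∃ Common-side
      common-side with any? (λ p → s p Boolₚ.≟ true) T
      ... | no none = false , λ T↭ sp → ⊥-elim (none (lose (↭⇒∈ T↭) sp))
      ... | yes some with find some
      ...   | u , u∈ , su with ∈⇒↭ u∈
      ...     | T₁ , T↭u = c (x ∷ x′ ∷ T₁) , λ T↭ sp → other-side-const T↭ T↭u sp su

      new-sides : ∀ {κ} → Common-side κ → ∀ {p F′} → x ∷ x′ ∷ T ↭ p ∷ F′ → c F′ ≡ s p ∧ κ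
      new-sides {κ} h {p} {F′} q with ∈-resp-↭ (↭-sym q) (here refl)
      ... | here refl = ≡.trans (c-resp (drop-∷ (↭-sym q))) (≡.trans cx′T (sym (cong (_∧ κ) (root st))))
      ... | there (here refl) = ≡.trans (c-resp (drop-∷ (trans (↭-sym q) p₁))) (≡.trans cxT (sym (cong (_∧ κ) (outside st x′∉))))
      ... | there (there p∈) with ∈⇒↭ p∈
      ...   | T′ , T↭ = ≡.trans (c-resp (drop-∷ (trans (↭-sym q) (trans (prep x (prep x′ T↭)) p₂)))) value
        where
        value : c (x ∷ x′ ∷ T′) ≡ s p ∧ κ
        value with s p in eq
        ... | true  = h T↭ eq
        ... | false = same-side T↭ eq

      -- If κ is true, the far class loses exactly `y` and `y′`; if κ is false, it becomes empty.
      -- Conjunction with κ expresses both at once, fresh vertices being on the root's side already.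
      new-state : ∀ {κ} → Common-side κ → State ws₂ z (x ∷ x′ ∷ T) (λ u → s u ∧ κ)
      new-state {κ} h = record
        { isEdge  = proj₁ f-Ed
        ; inside  = proj₂ f-Ed
        ; root    = cong (_∧ κ) (outside st (z∉ ∘ i₀₁))
        ; outside = λ u∉ → cong (_∧ κ) (outside st (λ u∈ → u∉ (i₁₂ (i₀₁ u∈))))
        ; sides   = new-sides h
        }

      new-trues : ∀ κ → (2 + trues (λ u → s u ∧ κ) (x ∷ x′ ∷ T) ≡ trues s F) ⊎ (trues (λ u → s u ∧ κ) (x ∷ x′ ∷ T) ≡ 0)
      new-trues true  = inj₁ (begin
        2 + trues (λ u → s u ∧ true) (x ∷ x′ ∷ T) ≡⟨ cong (2 +_) (trues-cong (x ∷ x′ ∷ T) (All.universal (λ u → Boolₚ.∧-identityʳ (s u)) (x ∷ x′ ∷ T))) ⟩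
        2 + trues s (x ∷ x′ ∷ T)                  ≡⟨ cong₂ (λ a b → 2 + (bit a + (bit b + trues s T))) (root st) (outside st x′∉) ⟩
        2 + trues s T                             ≡⟨ cong₂ (λ a b → bit a + (bit b + trues s T)) (sym sy) (sym sy′) ⟩
        trues s (y ∷ y′ ∷ T)                      ≡⟨ sym (trues-↭ s F↭) ⟩
        trues s F                                 ∎)
        where open ≡-Reasoning
      new-trues false = inj₂ (≡.trans (trues-cong (x ∷ x′ ∷ T) (All.universal (λ u → Boolₚ.∧-zeroʳ (s u)) (x ∷ x′ ∷ T))) (trues-false (x ∷ x′ ∷ T)))

    step : ∀ {ws₀ ws₁ ws₂} → Closed ws₀ ws₁ → (∀ {u} → u ∈ ws₀ → u ∈ ws₁) → Closed ws₁ ws₂ → (∀ {u} → u ∈ ws₁ → u ∈ ws₂) →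
           (∀ {u} → u ∈ ws₂ → u ∈ X) → ∀ {x F s} → State ws₀ x F s → 2 ≤ trues s F →
           ∃ λ x′ → ∃ λ F′ → ∃ λ s′ → State ws₂ x′ F′ s′ × ((2 + trues s′ F′ ≡ trues s F) ⊎ (trues s′ F′ ≡ 0))
    step cl₀₁ i₀₁ cl₁₂ i₁₂ i₂ {x} {F} {s} st 2≤ with trues-pick s F (≤-trans (s≤s z≤n) 2≤)
    ... | y , F₁ , F↭₁ , sy with trues-pick s F₁ (1≤ (subst (2 ≤_) (trues-↭ s F↭₁) 2≤))
      where
      1≤ : 2 ≤ trues s (y ∷ F₁) → 1 ≤ trues s F₁
      1≤ h rewrite sy = ≤-pred h
    ... | y′ , T , F₁↭ , sy′ = _ , _ , _ , new-state (proj₂ common-side) , new-trues (proj₁ common-side)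
      where open Step cl₀₁ i₀₁ cl₁₂ i₁₂ i₂ st (trans F↭₁ (prep y F₁↭)) sy sy′

    -- Exchanges the roles of the two classes.
    reroot : ∀ {ws x F s} → (∀ {u} → u ∈ ws → u ∈ X) → State ws x F s → 1 ≤ trues s F →
             ∃ λ x′ → ∃ λ F′ → ∃ λ s′ → State ws x′ F′ s′ × (trues s′ F′ + trues s F ≡ r)
    reroot {ws} {x} {F} {s} i st 1≤ with trues-pick s F 1≤
    ... | y , T , F↭ , sy = y , x ∷ T , s′ , record
        { isEdge  = E-resp e↭ (isEdge st)
        ; inside  = All-resp-↭ e↭ (inside st)
        ; root    = ≡.trans (s′-in (All.head (All-resp-↭ e↭ (inside st)))) (cong not sy)
        ; outside = s′-out
        ; sides   = sides′
        } , total
      where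
      -- Plain negation would mark every vertex outside `ws`; the membership test preserves
      -- `outside`.
      s′ : V → Bool
      s′ u = ⌊ u ∈? ws ⌋ ∧ not (s u)
      s′-in : ∀ {u} → u ∈ ws → s′ u ≡ not (s u)
      s′-in {u} u∈ with u ∈? ws
      ... | yes _ = refl
      ... | no u∉ = ⊥-elim (u∉ u∈)
      s′-out : ∀ {u} → u ∉ ws → s′ u ≡ false
      s′-out {u} u∉ with u ∈? ws
      ... | yes u∈ = ⊥-elim (u∉ u∈)
      ... | no _   = refl
      e↭ : x ∷ F ↭ y ∷ x ∷ T
      e↭ = trans (prep x F↭) p₁
      x∈ : x ∈ ws
      x∈ = All.head (inside st)
      T⊆ : All (_∈ ws) T
      T⊆ = All.tail (All.tail (All-resp-↭ e↭ (inside st)))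
      sides′ : ∀ {p F′} → x ∷ T ↭ p ∷ F′ → c F′ ≡ s′ p
      sides′ {p} {F′} q with ↭⇒∈ q
      ... | here refl = ≡.trans (c-resp (drop-∷ (↭-sym q))) (≡.trans (sides st F↭) (≡.trans sy (sym (≡.trans (s′-in x∈) (cong not (root st))))))
      ... | there p∈ with ∈⇒↭ p∈
      ...   | T′ , T↭ = ≡.trans (c-resp (drop-∷ (trans (↭-sym q) (trans (prep x T↭) p₁)))) (≡.trans value (sym (s′-in (All.lookup T⊆ p∈))))
        where
        F↭′ : F ↭ y ∷ p ∷ T′
        F↭′ = trans F↭ (prep y T↭)
        xyp : x ∷ F ↭ p ∷ y ∷ x ∷ T′
        xyp = trans (prep x F↭′) (p₂ ◂ p₁)
        value : c (x ∷ T′) ≡ not (s p)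
        value = ≡.trans (xor-solve (c (p ∷ T′)) (c (y ∷ T′)) (c (x ∷ T′)) {true} {s p}
          (cut (E-resp xyp (isEdge st)) (All.map i (All-resp-↭ xyp (inside st))))
          (≡.trans (sides st F↭′) sy) (sides st (trans F↭′ p₁))) refl
      total : trues s′ (x ∷ T) + trues s F ≡ r
      total = begin
        trues s′ (x ∷ T) + trues s F              ≡⟨ cong₂ _+_ (trues-cong (x ∷ T) (All.map s′-in (x∈ ∷ T⊆))) (trues-↭ s F↭) ⟩
        trues (not ∘ s) (x ∷ T) + trues s (y ∷ T) ≡⟨ cong₂ (λ a b → bit (not a) + trues (not ∘ s) T + (bit b + trues s T)) (root st) sy ⟩
        suc (trues (not ∘ s) T) + suc (trues s T) ≡⟨ cong suc (+-suc _ _) ⟩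
        2 + (trues (not ∘ s) T + trues s T)       ≡⟨ cong (2 +_) (trues-not s T) ⟩
        2 + length T                              ≡⟨ sym (↭-length e↭) ⟩
        length (x ∷ F)                            ≡⟨ E-length (isEdge st) ⟩
        r                                         ∎
        where open ≡-Reasoning

    initial : ∀ {ws ws₁ S} → Closed ws ws₁ → Admissible ws S → (∀ {u} → u ∈ ws → u ∈ ws₁) →
              ∃ λ x → ∃ λ s → State ws₁ x S s
    initial {ws} {ws₁} {S} cl adm i with cl S S S adm adm adm
    ... | x , x∈ , x∉ , two = x , s , record
        { isEdge  = TwoOf-same two
        ; inside  = x∈ ∷ All.map i (proj₁ adm)
        ; root    = s-out (λ x∈S → x∉ (All.lookup (proj₁ adm) x∈S))
        ; outside = λ u∉ → s-out (λ u∈S → u∉ (i (All.lookup (proj₁ adm) u∈S)))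
        ; sides   = sides′
        }
      where
      -- The tail in `sides` is determined up to order by the vertex removed, so the side of `u` can
      -- be read off from `S` with `u` filtered out.
      without : V → List V
      without u = filter (λ v → ¬? (u ≟ v)) S
      s : V → Bool
      s u = ⌊ u ∈? S ⌋ ∧ c (without u)
      s-out : ∀ {u} → u ∉ S → s u ≡ false
      s-out {u} u∉ with u ∈? S
      ... | yes u∈ = ⊥-elim (u∉ u∈)
      ... | no _   = refl
      sides′ : ∀ {p F′} → S ↭ p ∷ F′ → c F′ ≡ s p
      sides′ {p} {F′} q with p ∈? S
      ... | no p∉ = ⊥-elim (p∉ (↭⇒∈ q))
      ... | yes _ with Unique-resp-↭ q (proj₁ (proj₂ adm))
      ...   | p≢ ∷ _ = sym (c-resp (trans (filter-↭ (λ v → ¬? (p ≟ v)) q) (subst (_↭ F′) (sym eq) refl)))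
        where
        eq : filter (λ v → ¬? (p ≟ v)) (p ∷ F′) ≡ F′
        eq = ≡.trans (filter-reject (λ v → ¬? (p ≟ v)) (λ n → n refl)) (filter-all (λ v → ¬? (p ≟ v)) p≢)

    grow : ∀ {ws ws′ x F s} → (∀ {u} → u ∈ ws → u ∈ ws′) → State ws x F s → State ws′ x F s
    grow i st = record { isEdge = isEdge st ; inside = All.map i (inside st) ; root = root st ; outside = λ u∉ → outside st (u∉ ∘ i) ; sides = sides st }

    trues≤r : ∀ {ws x F s} → State ws x F s → trues s F ≤ r
    trues≤r {F = F} {s} st = begin
      trues s F                       ≤⟨ m≤n+m (trues s F) (trues (not ∘ s) F) ⟩
      trues (not ∘ s) F + trues s F   ≡⟨ trues-not s F ⟩
      length F                        ≤⟨ n≤1+n (length F) ⟩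
      suc (length F)                  ≡⟨ E-length (isEdge st) ⟩
      r                               ∎
      where open ≤-Reasoning

    module _ (q : ℕ) (noBalanced : ∀ {x F s} → State X x F s → q ∣ trues s F → ⊥) where

      -- The target `g` is 0 or q. A step may instead empty the far class, which also ends the
      -- descent because q divides 0.
      descend : ∀ d {ws x F s} j g → j ≤ d → Chain X ws d → State ws x F s → trues s F ≡ j * 2 + g → q ∣ g → ⊥
      descend d zero g _ ch st eq q∣g = noBalanced (grow (Chain⇒⊆ ch) st) (subst (q ∣_) (sym eq) q∣g)
      descend (suc d) {F = F} {s} (suc j) g (s≤s j≤d) (more {ws₂ = ws₂} cl₀₁ i₀₁ cl₁₂ i₁₂ ch) st eq q∣g =
        continue (step cl₀₁ i₀₁ cl₁₂ i₁₂ (Chain⇒⊆ ch) st (≤-trans (m≤m+n 2 (j * 2 + g)) (≤-reflexive (sym eq))))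
        where
        continue : (∃ λ x′ → ∃ λ F′ → ∃ λ s′ → State ws₂ x′ F′ s′ × ((2 + trues s′ F′ ≡ trues s F) ⊎ (trues s′ F′ ≡ 0))) → ⊥
        continue (_ , _ , _ , st′ , inj₁ eq′) = descend d j g j≤d ch st′ (+-cancelˡ-≡ 2 _ _ (≡.trans eq′ eq)) q∣g
        continue (_ , _ , _ , st′ , inj₂ eq′) = descend d 0 0 z≤n ch st′ eq′ (q ∣0)

      even-trues : ∀ {ws x F s} j → Chain X ws r → State ws x F s → trues s F ≡ j * 2 → ⊥
      even-trues {F = F} {s} j ch st eq = descend r j 0 j≤r ch st (≡.trans eq (sym (+-identityʳ _))) (q ∣0)
        where
        j≤r : j ≤ r
        j≤r = ≤-trans (m≤m*n j 2) (≤-trans (≤-reflexive (sym eq)) (trues≤r st))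

      odd-trues : ∀ {ws x F s} j p → Chain X ws r → State ws x F s → trues s F ≡ suc (j * 2) → q ≡ suc (p * 2) → p ≤ j → ⊥
      odd-trues j p ch st eq q≡ p≤j = descend r (j ∸ p) q j∸p≤r ch st (≡.trans eq split) ∣-refl
        where
        j∸p≤r : j ∸ p ≤ r
        j∸p≤r = ≤-trans (m∸n≤m j p) (≤-trans (m≤m*n j 2) (≤-trans (n≤1+n _) (≤-trans (≤-reflexive (sym eq)) (trues≤r st))))
        split : suc (j * 2) ≡ (j ∸ p) * 2 + q
        split = begin
          suc (j * 2)                   ≡⟨ cong (λ i → suc (i * 2)) (sym (m∸n+n≡m p≤j)) ⟩
          suc ((j ∸ p + p) * 2)         ≡⟨ cong suc (*-distribʳ-+ 2 (j ∸ p) p) ⟩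
          suc ((j ∸ p) * 2 + p * 2)     ≡⟨ sym (+-suc _ _) ⟩
          (j ∸ p) * 2 + suc (p * 2)     ≡⟨ cong ((j ∸ p) * 2 +_) (sym q≡) ⟩
          (j ∸ p) * 2 + q               ∎
          where open ≡-Reasoning

      -- Steps of two preserve parity until the far class is emptied. An even b descends to 0. If b
      -- and r are odd, exchanging the classes makes b even. If b is odd and r even, then 2q ≤ r, so
      -- b or r - b is at least q; both are odd, and the larger target q is reached in steps of two.
      -- With q = 2p + 1 and b = 2j + 1, the test `p ≤? j` decides whether q ≤ b.
      no-state : ∀ {ws x F s} p → q ≡ suc (p * 2) → q ∣ r → Chain X ws r → State ws x F s → ⊥
      no-state {ws} {F = F} {s} p q≡ q∣r ch st = by-parity (even-or-odd (trues s F)) (even-or-odd r)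
        where
        1≤ : ∀ j → trues s F ≡ suc (j * 2) → 1 ≤ trues s F
        1≤ j eq = subst (1 ≤_) (sym eq) (s≤s z≤n)

        Rerooted : Set
        Rerooted = ∃ λ x′ → ∃ λ F′ → ∃ λ s′ → State ws x′ F′ s′ × (trues s′ F′ + trues s F ≡ r)

        odd+odd : ∀ {a b} i j k → a ≡ suc (i * 2) → b ≡ suc (j * 2) → a + b ≡ suc (k * 2) → ⊥
        odd+odd i j k refl refl eq = even≢odd (i + suc j) k (≡.trans (cong (_* 2) (+-comm i (suc j))) (≡.trans (even i j) (≡.trans eq refl)))
          where
          even : ∀ i j → (suc j + i) * 2 ≡ suc (i * 2) + suc (j * 2)
          even i j = ≡.trans (*-distribʳ-+ 2 (suc j) i) (≡.trans (+-comm (suc j * 2) (i * 2)) (+-suc (i * 2) (suc (j * 2))))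

        odd+even : ∀ {a b} i j k → a ≡ i * 2 → b ≡ suc (j * 2) → a + b ≡ k * 2 → ⊥
        odd+even i j k refl refl eq = even≢odd k (i + j) (≡.trans (sym eq) (≡.trans (+-suc _ _) (cong suc (sym (*-distribʳ-+ 2 i j)))))

        odd-r : ∀ i j → r ≡ suc (i * 2) → trues s F ≡ suc (j * 2) → Rerooted → ⊥
        odd-r i j r≡ b≡ (_ , F′ , s′ , st′ , total) with even-or-odd (trues s′ F′)
        ... | j′ , inj₁ b′≡ = even-trues j′ ch st′ b′≡
        ... | j′ , inj₂ b′≡ = odd+odd j′ j i b′≡ b≡ (≡.trans total r≡)

        even-r : ∀ i j → r ≡ i * 2 → trues s F ≡ suc (j * 2) → ¬ (p ≤ j) → Rerooted → ⊥
        even-r i j r≡ b≡ p≰j (_ , F′ , s′ , st′ , total) with even-or-odd (trues s′ F′)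
        ... | j′ , inj₁ b′≡ = odd+even j′ j i b′≡ b≡ (≡.trans total r≡)
        ... | j′ , inj₂ b′≡ = odd-trues j′ p ch st′ b′≡ q≡ (q≤b′⇒p≤j′ (+-cancelʳ-≤ (trues s F) _ _ (begin
            q + trues s F             ≤⟨ +-monoʳ-≤ q b≤q ⟩
            q + q                     ≤⟨ 2q≤r q∣r ⟩
            r                         ≡⟨ sym total ⟩
            trues s′ F′ + trues s F   ∎)))
          where
          open ≤-Reasoning
          b≤q : trues s F ≤ q
          b≤q = subst₂ _≤_ (sym b≡) (sym q≡) (s≤s (*-monoˡ-≤ 2 (<⇒≤ (≰⇒> p≰j))))
          q≤b′⇒p≤j′ : q ≤ trues s′ F′ → p ≤ j′
          q≤b′⇒p≤j′ le = *-cancelʳ-≤ p j′ 2 (≤-pred (subst₂ _≤_ q≡ b′≡ le))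
          -- Since r is positive and even while q is odd, r is a multiple of q other than 0 and q.
          2q≤r : q ∣ r → q + q ≤ r
          2q≤r (divides zero r≡0) = ⊥-elim (1+n≢0 (≡.trans (sym b≡) (n≤0⇒n≡0 (subst (trues s F ≤_) r≡0 (trues≤r st)))))
          2q≤r (divides (suc zero) r≡q) = ⊥-elim (even≢odd i p (≡.trans (sym r≡) (≡.trans r≡q (≡.trans (+-identityʳ q) q≡))))
          2q≤r (divides (suc (suc m)) eq) = subst (q + q ≤_) (sym (≡.trans eq (sym (+-assoc q q (m * q))))) (m≤m+n (q + q) (m * q))

        by-parity : (∃ λ j → (trues s F ≡ j * 2) ⊎ (trues s F ≡ suc (j * 2))) → (∃ λ i → (r ≡ i * 2) ⊎ (r ≡ suc (i * 2))) → ⊥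
        by-parity (j , inj₁ b≡) _                = even-trues j ch st b≡
        by-parity (j , inj₂ b≡) (i , inj₂ r≡)    = odd-r i j r≡ b≡ (reroot (Chain⇒⊆ ch) st (1≤ j b≡))
        by-parity (j , inj₂ b≡) (i , inj₁ r≡) with p ≤? j
        ... | yes p≤j = odd-trues j p ch st b≡ q≡ p≤j
        ... | no p≰j  = even-r i j r≡ b≡ p≰j (reroot (Chain⇒⊆ ch) st (1≤ j b≡))

      -- The extra unit of the index pays for the first edge; the remaining r units suffice because
      -- the far class has at most r vertices.
      no-chain : ∀ {ws S} p → q ≡ suc (p * 2) → q ∣ r → Chain X ws (suc r) → Admissible ws S → ⊥
      no-chain p q≡ q∣r (more cl₀₁ i₀₁ cl₁₂ i₁₂ ch) adm = start (initial cl₀₁ adm i₀₁)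
        where
        start : (∃ λ x → ∃ λ s → State _ x _ s) → ⊥
        start (_ , _ , st) = no-state p q≡ q∣r ch (grow i₁₂ st)

-- Exchanging vertices of an ordered edge

module _ {V : Set} where

  -- The permutation of positions underlying a proof of xs ↭ ys, applied to an arbitrary list.
  act : ∀ {xs ys : List V} → xs ↭ ys → List V → List V
  act refl         zs           = zs
  act (prep _ ρ)   []           = []
  act (prep _ ρ)   (z ∷ zs)     = z ∷ act ρ zs
  act (swap _ _ ρ) []           = []
  act (swap _ _ ρ) (z ∷ [])     = z ∷ []
  act (swap _ _ ρ) (z ∷ w ∷ zs) = w ∷ z ∷ act ρ zs
  act (trans ρ σ)  zs           = act σ (act ρ zs)

  act-self : ∀ {xs ys : List V} (ρ : xs ↭ ys) → act ρ xs ≡ ys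
  act-self refl         = refl
  act-self (prep x ρ)   = cong (x ∷_) (act-self ρ)
  act-self (swap x y ρ) = cong (λ l → y ∷ x ∷ l) (act-self ρ)
  act-self (trans ρ σ)  = ≡.trans (cong (act σ) (act-self ρ)) (act-self σ)

  act-↭ : ∀ {xs ys : List V} (ρ : xs ↭ ys) zs → zs ↭ act ρ zs
  act-↭ refl         zs           = refl
  act-↭ (prep _ ρ)   []           = refl
  act-↭ (prep _ ρ)   (z ∷ zs)     = prep z (act-↭ ρ zs)
  act-↭ (swap _ _ ρ) []           = refl
  act-↭ (swap _ _ ρ) (z ∷ [])     = refl
  act-↭ (swap _ _ ρ) (z ∷ w ∷ zs) = swap z w (act-↭ ρ zs)
  act-↭ (trans ρ σ)  zs           = trans (act-↭ ρ zs) (act-↭ σ (act ρ zs))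

  -- The new entry may equal the old one, which permits the idle moves that pad a walk to a
  -- prescribed length.
  data OneChange : List V → List V → Set where
    here  : ∀ {p p′ xs} → OneChange (p ∷ xs) (p′ ∷ xs)
    there : ∀ {x xs ys} → OneChange xs ys → OneChange (x ∷ xs) (x ∷ ys)

  OneChange-sym : ∀ {xs ys} → OneChange xs ys → OneChange ys xs
  OneChange-sym here      = here
  OneChange-sym (there c) = there (OneChange-sym c)

  OneChange-act : ∀ {xs ys : List V} (ρ : xs ↭ ys) {as bs} → OneChange as bs → OneChange (act ρ as) (act ρ bs)
  OneChange-act refl         ch                        = ch
  OneChange-act (prep _ ρ)   here                      = here
  OneChange-act (prep _ ρ)   (there ch)                = there (OneChange-act ρ ch)
  OneChange-act (swap _ _ ρ) (here {xs = []})          = here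
  OneChange-act (swap _ _ ρ) (here {xs = _ ∷ _})       = there here
  OneChange-act (swap _ _ ρ) (there here)              = here
  OneChange-act (swap _ _ ρ) (there (there ch))        = there (there (OneChange-act ρ ch))
  OneChange-act (trans ρ σ)  ch                        = OneChange-act σ (OneChange-act ρ ch)

  move : ∀ y (xs ys : List V) → y ∷ xs ++ ys ↭ xs ++ y ∷ ys
  move y []       ys = refl
  move y (x ∷ xs) ys = trans (swap y x refl) (prep x (move y xs ys))

  act-move : ∀ y (xs ys : List V) w zs → act (move y xs ys) (w ∷ xs ++ zs) ≡ xs ++ w ∷ zs
  act-move y []       ys w zs = refl
  act-move y (x ∷ xs) ys w zs = cong (x ∷_) (act-move y xs ys w zs)

  fill : (σ : V → Bool) (P : List Bool) (L : List V) → length L ≡ length P → trues σ L ≡ trues id P →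
         ∃ λ L′ → (L ↭ L′) × (map σ L′ ≡ P)
  fill σ []          []      len eq = [] , refl , refl
  fill σ (true ∷ P)  L       len eq with trues-pick σ L (subst (1 ≤_) (sym eq) (s≤s z≤n))
  ... | y , T , L↭ , σy with fill σ P T (suc-injective (≡.trans (sym (↭-length L↭)) len))
                                        (suc-injective (≡.trans (cong (λ b → bit b + trues σ T) (sym σy)) (≡.trans (sym (trues-↭ σ L↭)) eq)))
  ...   | T′ , T↭ , eq′ = y ∷ T′ , trans L↭ (prep y T↭) , cong₂ _∷_ σy eq′
  fill σ (false ∷ P) L       len eq with trues-pick (not ∘ σ) L pos
    where
    pos : 1 ≤ trues (not ∘ σ) L
    pos = +-cancelʳ-≤ (trues σ L) _ _ (begin
      1 + trues σ L                     ≡⟨ cong suc eq ⟩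
      1 + trues id P                    ≤⟨ s≤s (≤-trans (m≤n+m (trues id P) (trues not P)) (≤-reflexive (trues-not id P))) ⟩
      1 + length P                      ≡⟨ sym len ⟩
      length L                          ≡⟨ sym (trues-not σ L) ⟩
      trues (not ∘ σ) L + trues σ L     ∎)
      where open ≤-Reasoning
  ... | y , T , L↭ , ¬σy with fill σ P T (suc-injective (≡.trans (sym (↭-length L↭)) len))
                                        (≡.trans (cong (λ b → bit b + trues σ T) (sym σy)) (≡.trans (sym (trues-↭ σ L↭)) eq))
    where
    σy : σ y ≡ false
    σy = ≡.trans (sym (Boolₚ.not-involutive (σ y))) (cong not ¬σy)
  ...   | T′ , T↭ , eq′ = y ∷ T′ , trans L↭ (prep y T↭) , cong₂ _∷_ (≡.trans (sym (Boolₚ.not-involutive (σ y))) (cong not ¬σy)) eq′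

-- Periodic patterns, and decisions under double negation

power : {A : Set} → List A → ℕ → List A
power b n = concat (replicate n b)

power-+ : {A : Set} (b : List A) (m n : ℕ) → power b (m + n) ≡ power b m ++ power b n
power-+ b zero    n = refl
power-+ b (suc m) n = ≡.trans (cong (b ++_) (power-+ b m n)) (sym (++-assoc b _ _))

length-power : {A : Set} (b : List A) (n : ℕ) → length (power b n) ≡ n * length b
length-power b zero    = refl
length-power b (suc n) = ≡.trans (length-++ b) (cong (length b +_) (length-power b n))

trues-++ : {A : Set} (s : A → Bool) (xs ys : List A) → trues s (xs ++ ys) ≡ trues s xs + trues s ys
trues-++ s []       ys = refl
trues-++ s (x ∷ xs) ys = ≡.trans (cong (bit (s x) +_) (trues-++ s xs ys)) (sym (+-assoc (bit (s x)) _ _))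

trues-power : (b : List Bool) (n : ℕ) → trues id (power b n) ≡ n * trues id b
trues-power b zero    = refl
trues-power b (suc n) = ≡.trans (trues-++ id b (power b n)) (cong (trues id b +_) (trues-power b n))

-- b times true, then d - b times false (if b ≤ d).
block : ℕ → ℕ → List Bool
block zero    zero    = []
block zero    (suc d) = false ∷ block zero d
block (suc b) zero    = []
block (suc b) (suc d) = true ∷ block b d

length-block : ∀ b d → length (block b d) ≡ d
length-block zero    zero    = refl
length-block zero    (suc d) = cong suc (length-block zero d)
length-block (suc b) zero    = refl
length-block (suc b) (suc d) = cong suc (length-block b d)

trues-block : ∀ b d → b ≤ d → trues id (block b d) ≡ b
trues-block zero    zero    _        = refl
trues-block zero    (suc d) _        = trues-block zero d z≤n
trues-block (suc b) (suc d) (s≤s le) = cong suc (trues-block b d le)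

++-split : ∀ {A B : Set} (f : A → B) L {xs ys} → map f L ≡ xs ++ ys →
           ∃ λ Z → ∃ λ G → (L ≡ Z ++ G) × (map f Z ≡ xs) × (map f G ≡ ys)
++-split f L {[]} eq = [] , L , refl , refl , eq
++-split f (l ∷ L) {x ∷ xs} eq with ∷-injective eq
... | refl , eq′ with ++-split f L {xs} eq′
...   | Z , G , refl , eqZ , eqG = l ∷ Z , G , refl , cong (_ ∷_) eqZ , eqG

¬¬-all : ∀ {A : Set} (xs : List A) {Q : A → Set} → (∀ u → ¬ ¬ Q u) → ¬ ¬ All Q xs
¬¬-all []       h k = k []
¬¬-all (x ∷ xs) h k = h x (λ q → ¬¬-all xs h (λ qs → k (q ∷ qs)))

-- Excluded middle holds under double negation for one list, and the bounds on length and entries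
-- leave finitely many lists, whose instances can be combined.
¬¬-decidable : ∀ {A : Set} (xs : List A) m (P : List A → Set) →
               ¬ ¬ (∀ L → length L ≡ m → All (_∈ xs) L → Dec (P L))
¬¬-decidable xs zero P k = ¬¬-excluded-middle (λ d → k (λ { [] _ _ → d }))
¬¬-decidable xs (suc m) P k =
  ¬¬-all xs (λ u → ¬¬-decidable xs m (λ L → P (u ∷ L)))
    (λ d → k (λ { (u ∷ L) len (u∈ ∷ L⊆) → All.lookup d u∈ L (suc-injective len) L⊆ }))

module Moves {V : Set} (E : List V → Set) (W : List V) where

  EW : List V → Set
  EW L = E L × All (_∈ W) L

  Move : List V → List V → Set
  Move L M = OneChange L M × EW L × EW M

-- The edges compared lie in `X`, while the paths between them run through `W`, where the common
-- neighbours of sets in `X` are found.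
module Paths {V : Set} (_≟_ : DecidableEquality V) (r : ℕ) (E : List V → Set)
             (E-resp : ∀ {L L′} → L ↭ L′ → E L → E L′) (E-unique : ∀ {L} → E L → Unique L)
             (E-length : ∀ {L} → E L → length L ≡ r) (E? : ∀ L → Dec (E L))
             (X W : List V) (X⊆W : ∀ {u} → u ∈ X → u ∈ W) where

  open Common _≟_ r E
  open Moves E W
  open import Data.List.Membership.DecPropositional _≟_ using (_∈?_)

  EX : List V → Set
  EX L = E L × All (_∈ X) L

  EW-resp : ∀ {L L′} → L ↭ L′ → EW L → EW L′
  EW-resp p (e , a) = E-resp p e , All-resp-↭ p a

  EX-resp : ∀ {L L′} → L ↭ L′ → EX L → EX L′
  EX-resp p (e , a) = E-resp p e , All-resp-↭ p a

  EX⇒EW : ∀ {L} → EX L → EW L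
  EX⇒EW (e , a) = e , All.map X⊆W a

  _≈_ : List V → List V → Set
  _≈_ = Star Move

  ≈-sym : ∀ {L M} → L ≈ M → M ≈ L
  ≈-sym = reverse (λ { (ch , e , e′) → OneChange-sym ch , e′ , e })

  -- A fixed permutation of positions keeps edges edges and single changes single, so a path between
  -- two orderings can be moved to any other positions.
  ≈-act : ∀ {xs ys : List V} (ρ : xs ↭ ys) {L M} → L ≈ M → act ρ L ≈ act ρ M
  ≈-act ρ = gmap (act ρ) (λ { {L} {M} (ch , e , e′) → OneChange-act ρ ch , EW-resp (act-↭ ρ L) e , EW-resp (act-↭ ρ M) e′ })

  Joined : V → V → List V → Set
  Joined u v R = (u ∷ v ∷ R) ≈ (v ∷ u ∷ R)

  Joined-resp : ∀ {u v R R′} → R ↭ R′ → Joined u v R → Joined u v R′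
  Joined-resp {u} {v} p j = subst₂ _≈_ (cong (λ l → u ∷ v ∷ l) (act-self p)) (cong (λ l → v ∷ u ∷ l) (act-self p))
    (≈-act (prep u (prep v p)) j)

  -- The exchange of `v` and `w`, conjugated by the exchange of `u` and `v`.
  Joined-trans : ∀ {u v w R} → Joined u v (w ∷ R) → Joined v w (u ∷ R) → Joined u w (v ∷ R)
  Joined-trans {u} {v} {w} {R} uv vw =
    ≈-act (prep u (swap v w (refl {xs = R}))) uv ◅◅ vw ◅◅ ≈-act (p₂ {a = u} {v} {w} {R}) (≈-sym uv)

  -- The vertex `z` is temporary storage: it takes the place of `u`, then `u` that of `v`, and
  -- finally `v` that of `z`.
  common-neighbour⇒Joined : ∀ {u v z S} → EW (u ∷ v ∷ S) → EW (z ∷ v ∷ S) → EW (z ∷ u ∷ S) → Joined u v S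
  common-neighbour⇒Joined e e₁ e₂ = (here , e , e₁) ◅ (there here , e₁ , e₂) ◅ (here , e₂ , EW-resp p₁ e) ◅ ε

  exchange : ∀ {p p′} pre xs ys → Joined p p′ ((pre ++ xs) ++ ys) → (pre ++ p ∷ xs ++ p′ ∷ ys) ≈ (pre ++ p′ ∷ xs ++ p ∷ ys)
  exchange {p} {p′} pre xs ys j = subst₂ _≈_ (act-move p pre (xs ++ p′ ∷ ys) p _) (act-move p pre (xs ++ p′ ∷ ys) p′ _)
    (≈-act (move p pre (xs ++ p′ ∷ ys)) (subst₂ _≈_
      (cong (p ∷_) (≡.trans (act-move p′ (pre ++ xs) ys p′ ys) (++-assoc pre xs _)))
      (cong (p′ ∷_) (≡.trans (act-move p′ (pre ++ xs) ys p ys) (++-assoc pre xs _)))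
      (≈-act (prep p (move p′ (pre ++ xs) ys)) j)))

  module _ (σ : V → Bool) (e : List V) (joined : ∀ {p p′ R} → e ↭ p ∷ p′ ∷ R → σ p ≡ σ p′ → Joined p p′ R) where

    -- Selection sort: the entry wanted next is exchanged with the current one, which has the same
    -- σ-value because the patterns agree. The recursion runs on the length `k`, since the rest of
    -- the list is rebuilt after an exchange.
    rearrange : ∀ k pre L L′ → length L ≡ k → e ↭ pre ++ L → L ↭ L′ → map σ L ≡ map σ L′ → (pre ++ L) ≈ (pre ++ L′)
    rearrange zero pre [] L′ _ _ L↭ _ with ↭-empty-inv (↭-sym L↭)
    ... | refl = ε
    rearrange (suc k) pre (p ∷ l) []        _ _ L↭ ()
    rearrange (suc k) pre (p ∷ l) (p′ ∷ l′) len e↭ L↭ eq with ∈-resp-↭ (↭-sym L↭) (here refl)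
    ... | here refl = subst₂ _≈_ (++-assoc pre (p ∷ []) l) (++-assoc pre (p ∷ []) l′)
            (rearrange k (pre ++ p ∷ []) l l′ (suc-injective len)
              (trans e↭ (↭-reflexive (sym (++-assoc pre (p ∷ []) l)))) (drop-∷ L↭) (proj₂ (∷-injective eq)))
    ... | there p′∈ with ∈-∃++ p′∈
    ...   | xs , ys , refl = exchange pre xs ys j ◅◅ subst₂ _≈_ (++-assoc pre (p′ ∷ []) _) (++-assoc pre (p′ ∷ []) _)
            (rearrange k (pre ++ p′ ∷ []) (xs ++ p ∷ ys) l′
              (≡.trans (≡.trans (length-++ xs) (sym (length-++ xs))) (suc-injective len))
              (trans e↭ (trans swapped (↭-reflexive (sym (++-assoc pre (p′ ∷ []) _)))))
              (drop-∷ (trans (trans (prep p′ (shift p xs ys)) (trans p₁ (prep p (↭-sym (shift p′ xs ys))))) L↭))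
              (≡.trans same (proj₂ (∷-injective eq))))
      where
      σp : σ p ≡ σ p′
      σp = proj₁ (∷-injective eq)
      flip : p ∷ xs ++ p′ ∷ ys ↭ p′ ∷ xs ++ p ∷ ys
      flip = trans (prep p (shift p′ xs ys)) (trans p₁ (prep p′ (↭-sym (shift p xs ys))))
      swapped : pre ++ p ∷ xs ++ p′ ∷ ys ↭ pre ++ p′ ∷ xs ++ p ∷ ys
      swapped = ++⁺ˡ pre flip
      j : Joined p p′ ((pre ++ xs) ++ ys)
      j = joined (trans e↭ (trans (shift p pre _) (prep p (trans (↭-reflexive (sym (++-assoc pre xs (p′ ∷ ys)))) (shift p′ (pre ++ xs) ys))))) σp
      same : map σ (xs ++ p ∷ ys) ≡ map σ (xs ++ p′ ∷ ys)
      same = ≡.trans (map-++ σ xs (p ∷ ys)) (≡.trans (cong (λ b → map σ xs ++ b ∷ map σ ys) σp) (sym (map-++ σ xs (p′ ∷ ys))))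

  module Separation (closed : Closed X W)
                    (joined? : ∀ u v R → EX (u ∷ v ∷ R) → Dec (Joined u v R)) where

    admissible : ∀ {L z S} → EX L → L ↭ z ∷ S → Admissible X S
    admissible (e , a) p with E-unique (E-resp p e) | All-resp-↭ p a
    ... | _ ∷ u | _ ∷ S⊆ = S⊆ , u , ≡.trans (sym (↭-length p)) (E-length e)

    extend : ∀ {w S} → w ∈ W → Admissible X S → E (w ∷ S) → EW (w ∷ S)
    extend w∈ (a , _) e = e , w∈ ∷ All.map X⊆W a

    -- In the link graph of R, two of u′, v′ and u have a common neighbour z: either u′ v′ z is a triangle,
    -- or there is a path of length three between the edges u v and u′ v′.
    transfer : ∀ {u v u′ v′ R} → EX (u ∷ v ∷ R) → EX (u′ ∷ v′ ∷ R) → Joined u v R → Joined u′ v′ R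
    transfer {u} {v} {u′} {v′} {R} e e′ j = conclude (closed _ _ _ adm₁ adm₂ adm₃)
      where
      adm₁ : Admissible X (u′ ∷ R)
      adm₁ = admissible e′ p₁
      adm₂ : Admissible X (v′ ∷ R)
      adm₂ = admissible e′ refl
      adm₃ : Admissible X (u ∷ R)
      adm₃ = admissible e p₁
      eW : EW (u ∷ v ∷ R)
      eW = EX⇒EW e
      e′W : EW (u′ ∷ v′ ∷ R)
      e′W = EX⇒EW e′
      conclude : (∃ λ z → (z ∈ W) × (z ∉ X) × TwoOf z (u′ ∷ R) (v′ ∷ R) (u ∷ R)) → Joined u′ v′ R
      conclude (z , z∈ , _ , inj₁ (e₁ , e₂)) = common-neighbour⇒Joined e′W (extend z∈ adm₂ e₂) (extend z∈ adm₁ e₁)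
      conclude (z , z∈ , _ , inj₂ (inj₁ (e₁ , e₃))) = path ◅◅ j ◅◅ ≈-act (swap u v (refl {xs = R})) (≈-sym path)
        where
        path : (u′ ∷ v′ ∷ R) ≈ (u ∷ v ∷ R)
        path = (there here , e′W , EW-resp p₁ (extend z∈ adm₁ e₁)) ◅
               (here , EW-resp p₁ (extend z∈ adm₁ e₁) , EW-resp p₁ (extend z∈ adm₃ e₃)) ◅
               (there here , EW-resp p₁ (extend z∈ adm₃ e₃) , eW) ◅ ε
      conclude (z , z∈ , _ , inj₂ (inj₂ (e₂ , e₃))) = path ◅◅ ≈-sym j ◅◅ ≈-act (swap v u (refl {xs = R})) (≈-sym path)
        where
        path : (u′ ∷ v′ ∷ R) ≈ (v ∷ u ∷ R)
        path = (here , e′W , extend z∈ adm₂ e₂) ◅ (there here , extend z∈ adm₂ e₂ , extend z∈ adm₃ e₃) ◅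
               (here , extend z∈ adm₃ e₃ , EW-resp p₁ eW) ◅ ε

    Separated : List V → V → V → Set
    Separated R u v = EX (u ∷ v ∷ R) × ¬ Joined u v R

    separated? : ∀ R u v → Dec (Separated R u v)
    separated? R u v with E? (u ∷ v ∷ R) ×-dec all? (_∈? X) (u ∷ v ∷ R)
    ... | no n  = no (n ∘ proj₁)
    ... | yes e with joined? u v R e
    ...   | yes j = no (λ s → proj₂ s j)
    ...   | no n  = yes (e , n)

    SomeSeparated : List V → Set
    SomeSeparated R = Any (λ u → Any (Separated R u) X) X

    someSeparated? : ∀ R → Dec (SomeSeparated R)
    someSeparated? R = any? (λ u → any? (separated? R u) X) X

    -- By `transfer`, one separated pair completing `R` to an edge inside `X` forces all such pairs
    -- to be separated. Lists `R` with no such completion receive `false`.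
    c : List V → Bool
    c R = does (someSeparated? R)

    c-true : ∀ {u v R} → EX (u ∷ v ∷ R) → ¬ Joined u v R → c R ≡ true
    c-true {R = R} e@(_ , u∈ ∷ v∈ ∷ _) n = dec-true (someSeparated? R) (lose u∈ (lose v∈ (e , n)))

    c-false : ∀ {u v R} → EX (u ∷ v ∷ R) → Joined u v R → c R ≡ false
    c-false {R = R} e j = dec-false (someSeparated? R) none
      where
      none : ¬ SomeSeparated R
      none s with Any.satisfied s
      ... | _ , s′ with Any.satisfied s′
      ...   | _ , (e′ , n) = n (transfer e e′ j)

    c-resp : ∀ {R R′} → R ↭ R′ → c R ≡ c R′
    c-resp {R} {R′} p with someSeparated? R
    ... | yes s = sym (dec-true (someSeparated? R′) (Any.map (Any.map move-sep) s))
      where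
      move-sep : ∀ {u v} → Separated R u v → Separated R′ u v
      move-sep (e , n) = EX-resp (prep _ (prep _ p)) e , n ∘ Joined-resp (↭-sym p)
    ... | no n = sym (dec-false (someSeparated? R′) (n ∘ Any.map (Any.map move-sep)))
      where
      move-sep : ∀ {u v} → Separated R′ u v → Separated R u v
      move-sep (e , n) = EX-resp (prep _ (prep _ (↭-sym p))) e , n ∘ Joined-resp p

    c-false⇒Joined : ∀ {u v R} → EX (u ∷ v ∷ R) → c R ≡ false → Joined u v R
    c-false⇒Joined {u} {v} {R} e eq with joined? u v R e
    ... | yes j = j
    ... | no n  = ⊥-elim (true≢false (≡.trans (sym (c-true e n)) eq))

    -- Among three vertices of an edge some two are exchangeable by closedness, and exchangeability
    -- is transitive; hence either none or exactly two of the three pairs are separated.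
    cut : ∀ {u v w R} → E (u ∷ v ∷ w ∷ R) → All (_∈ X) (u ∷ v ∷ w ∷ R) →
          c (u ∷ R) xor (c (v ∷ R) xor c (w ∷ R)) ≡ false
    cut {u} {v} {w} {R} e a = table (joined? v w (u ∷ R) evw) (joined? u w (v ∷ R) euw) (joined? u v (w ∷ R) (e , a))
      where
      evw : EX (v ∷ w ∷ u ∷ R)
      evw = EX-resp (p₁ ◂ p₁) (e , a)
      euw : EX (u ∷ w ∷ v ∷ R)
      euw = EX-resp (prep u p₁) (e , a)
      adm₁ : Admissible X (v ∷ w ∷ R)
      adm₁ = admissible (e , a) refl
      adm₂ : Admissible X (u ∷ w ∷ R)
      adm₂ = admissible (e , a) p₁
      adm₃ : Admissible X (u ∷ v ∷ R)
      adm₃ = admissible (e , a) p₂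
      some : (∃ λ z → (z ∈ W) × (z ∉ X) × TwoOf z (v ∷ w ∷ R) (u ∷ w ∷ R) (u ∷ v ∷ R)) →
             Joined v w (u ∷ R) ⊎ Joined u w (v ∷ R) ⊎ Joined u v (w ∷ R)
      some (z , z∈ , _ , inj₁ (e₁ , e₂)) = inj₂ (inj₂ (common-neighbour⇒Joined (EX⇒EW (e , a)) (extend z∈ adm₁ e₁) (extend z∈ adm₂ e₂)))
      some (z , z∈ , _ , inj₂ (inj₁ (e₁ , e₃))) = inj₂ (inj₁ (common-neighbour⇒Joined (EX⇒EW euw)
        (EW-resp (prep z p₁) (extend z∈ adm₁ e₁)) (extend z∈ adm₃ e₃)))
      some (z , z∈ , _ , inj₂ (inj₂ (e₂ , e₃))) = inj₁ (common-neighbour⇒Joined (EX⇒EW evw)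
        (EW-resp (prep z p₁) (extend z∈ adm₂ e₂)) (EW-resp (prep z p₁) (extend z∈ adm₃ e₃)))
      values : ∀ {α β γ} → c (u ∷ R) ≡ α → c (v ∷ R) ≡ β → c (w ∷ R) ≡ γ → α xor (β xor γ) ≡ false →
               c (u ∷ R) xor (c (v ∷ R) xor c (w ∷ R)) ≡ false
      values refl refl refl eq = eq
      table : Dec (Joined v w (u ∷ R)) → Dec (Joined u w (v ∷ R)) → Dec (Joined u v (w ∷ R)) →
              c (u ∷ R) xor (c (v ∷ R) xor c (w ∷ R)) ≡ false
      table (yes vw) (yes uw) (yes uv) = values (c-false evw vw) (c-false euw uw) (c-false (e , a) uv) refl
      table (yes vw) (no ¬uw) (no ¬uv) = values (c-false evw vw) (c-true euw ¬uw) (c-true (e , a) ¬uv) refl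
      table (no ¬vw) (yes uw) (no ¬uv) = values (c-true evw ¬vw) (c-false euw uw) (c-true (e , a) ¬uv) refl
      table (no ¬vw) (no ¬uw) (yes uv) = values (c-true evw ¬vw) (c-true euw ¬uw) (c-false (e , a) uv) refl
      table (yes vw) (yes uw) (no ¬uv) = ⊥-elim (¬uv (Joined-trans uw (≈-sym vw)))
      table (yes vw) (no ¬uw) (yes uv) = ⊥-elim (¬uw (Joined-trans uv vw))
      table (no ¬vw) (yes uw) (yes uv) = ⊥-elim (¬vw (Joined-trans (≈-sym uv) uw))
      table (no ¬vw) (no ¬uw) (no ¬uv) with some (closed _ _ _ adm₁ adm₂ adm₃)
      ... | inj₁ vw        = ⊥-elim (¬vw vw)
      ... | inj₂ (inj₁ uw) = ⊥-elim (¬uw uw)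
      ... | inj₂ (inj₂ uv) = ⊥-elim (¬uv uv)

    open Parity E-resp E-unique E-length X c c-resp cut public
    open State

    -- A state compares vertices with the root only. If neither `p` nor `p′` is the root, the cut
    -- identity on these three gives c R = s p + s p′ = 0.
    same-side⇒Joined : ∀ {x F s} → State X x F s → ∀ {p p′ R} → x ∷ F ↭ p ∷ p′ ∷ R → s p ≡ s p′ → Joined p p′ R
    same-side⇒Joined {x} {F} {s} st {p} {p′} {R} e↭ eq = c-false⇒Joined (EX-resp e↭ (isEdge st , inside st)) (value (↭⇒∈ e↭) (↭⇒∈ (trans e↭ p₁)))
      where
      value : p ∈ x ∷ F → p′ ∈ x ∷ F → c R ≡ false
      value (here refl) _ = ≡.trans (sides st (drop-∷ e↭)) (≡.trans (sym eq) (root st))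
      value (there _) (here refl) = ≡.trans (sides st (drop-∷ (trans e↭ p₁))) (≡.trans eq (root st))
      value (there p∈) (there p′∈) with ∈⇒↭ p∈
      ... | F₁ , F↭₁ with ∈-resp-↭ (drop-∷ (trans (↭-sym e↭) (trans (prep x F↭₁) p₁))) (here refl)
      ...   | here refl = ≡.trans (sides st (drop-∷ (trans e↭ p₁))) (≡.trans eq (root st))
      ...   | there p′∈₁ with ∈⇒↭ p′∈₁
      ...     | F₂ , F₁↭ = ≡.trans (c-resp R↭)
                  (≡.trans (xor-solve (c (p ∷ F₂)) (c (p′ ∷ F₂)) (c (x ∷ F₂)) (cut (E-resp xpp′ (isEdge st)) (All-resp-↭ xpp′ (inside st)))
                      (sides st (trans F↭ p₁)) (sides st F↭)) (≡.trans (cong (_xor s p) (sym eq)) (Boolₚ.xor-same (s p))))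
        where
        F↭ : F ↭ p ∷ p′ ∷ F₂
        F↭ = trans F↭₁ (prep p F₁↭)
        xpp′ : x ∷ F ↭ p ∷ p′ ∷ x ∷ F₂
        xpp′ = trans (prep x F↭) (p₁ ◂ p₁)
        R↭ : R ↭ x ∷ F₂
        R↭ = drop-∷ (drop-∷ (trans (↭-sym e↭) xpp′))

    -- The far class has b q vertices, so the edge can be ordered as q blocks of length d, each with
    -- b far vertices. Here `k` counts blocks: moving the first `k` of them to the end is a rotation
    -- by k d positions that preserves the pattern.
    balanced⇒rotation : ∀ {x F s} q d k → r ≡ d * q → 1 ≤ q → k ≤ q → State X x F s → q ∣ trues s F →
                        ∃ λ Z → ∃ λ G → (length Z ≡ k * d) × EW (Z ++ G) × ((G ++ Z) ≈ (Z ++ G))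
    balanced⇒rotation {x} {F} {s} q d k r≡ 1≤q k≤q st (divides b b≡) = rotate (fill s (power blk q) (x ∷ F) len tr)
      where
      blk : List Bool
      blk = block b d
      b≤d : b ≤ d
      b≤d = *-cancelʳ-≤ b d q {{>-nonZero 1≤q}} (subst₂ _≤_ b≡ r≡ (trues≤r st))
      len : length (x ∷ F) ≡ length (power blk q)
      len = ≡.trans (E-length (isEdge st)) (≡.trans r≡ (≡.trans (*-comm d q)
              (sym (≡.trans (length-power blk q) (cong (q *_) (length-block b d))))))
      tr : trues s (x ∷ F) ≡ trues id (power blk q)
      tr = ≡.trans (cong (λ b → bit b + trues s F) (root st)) (≡.trans b≡ (≡.trans (*-comm b q)
              (sym (≡.trans (trues-power blk q) (cong (q *_) (trues-block b d b≤d))))))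
      split : power blk q ≡ power blk k ++ power blk (q ∸ k)
      split = ≡.trans (cong (power blk) (sym (m+[n∸m]≡n k≤q))) (power-+ blk k (q ∸ k))
      split′ : power blk q ≡ power blk (q ∸ k) ++ power blk k
      split′ = ≡.trans (cong (power blk) (sym (m∸n+n≡m k≤q))) (power-+ blk (q ∸ k) k)
      rotate : (∃ λ L → (x ∷ F ↭ L) × (map s L ≡ power blk q)) →
               ∃ λ Z → ∃ λ G → (length Z ≡ k * d) × EW (Z ++ G) × ((G ++ Z) ≈ (Z ++ G))
      rotate (L , L↭ , eq) with ++-split s L {power blk k} {power blk (q ∸ k)} (≡.trans eq split)
      ... | Z , G , refl , eqZ , eqG = Z , G ,
            ≡.trans (sym (length-map s Z)) (≡.trans (cong length eqZ) (≡.trans (length-power blk k) (cong (k *_) (length-block b d)))) ,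
            EX⇒EW (EX-resp L↭ (isEdge st , inside st)) ,
            ≈-sym (rearrange s (x ∷ F) (same-side⇒Joined st) (length (Z ++ G)) [] (Z ++ G) (G ++ Z) refl L↭ (++-comm Z G)
              (≡.trans eq (≡.trans split′ (sym (≡.trans (map-++ s G Z) (cong₂ _++_ eqG eqZ))))))

-- Walks of prescribed length and cyclic words

module _ {A : Set} where

  lists : ℕ → List A → List (List A)
  lists zero    ws = [] ∷ []
  lists (suc k) ws = cartesianProductWith _∷_ ws (lists k ws)

  ∈-lists : ∀ {ws} L → All (_∈ ws) L → L ∈ lists (length L) ws
  ∈-lists []      []       = here refl
  ∈-lists (u ∷ L) (u∈ ∷ a) = ∈-cartesianProductWith⁺ _∷_ u∈ (∈-lists L a)

  length-product : ∀ {B C : Set} (f : A → B → C) xs ys → length (cartesianProductWith f xs ys) ≡ length xs * length ys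
  length-product f []       ys = refl
  length-product f (x ∷ xs) ys = ≡.trans (length-++ (map (f x) ys)) (cong₂ _+_ (length-map (f x) ys) (length-product f xs ys))

  length-lists : ∀ k ws → length (lists k ws) ≡ length ws ^ k
  length-lists zero    ws = refl
  length-lists (suc k) ws = ≡.trans (length-product _∷_ ws (lists k ws)) (cong (length ws *_) (length-lists k ws))

  Unique⇒length≤ : ∀ {vs Ω : List A} → Unique vs → All (_∈ Ω) vs → length vs ≤ length Ω
  Unique⇒length≤ [] [] = z≤n
  Unique⇒length≤ (x≢ ∷ u) (x∈ ∷ a) with ∈⇒↭ x∈
  ... | Ω′ , Ω↭ = ≤-trans (s≤s (Unique⇒length≤ u (All.zipWith other (x≢ , a)))) (≤-reflexive (sym (↭-length Ω↭)))
    where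
    other : ∀ {v} → (_ ≢ v) × (v ∈ _) → v ∈ Ω′
    other (x≢v , v∈) with ∈-resp-↭ Ω↭ v∈
    ... | here eq   = ⊥-elim (x≢v (sym eq))
    ... | there v∈′ = v∈′

  data Walk (R : A → A → Set) : ℕ → A → A → Set where
    []  : ∀ {x} → Walk R 0 x x
    _∷_ : ∀ {x y z n} → R x y → Walk R n y z → Walk R (suc n) x z

  module _ (_≟_ : DecidableEquality A) (R : A → A → Set) (Ω : List A) (R⊆Ω : ∀ {x y} → R x y → x ∈ Ω) where

    open import Data.List.Membership.DecPropositional _≟_ using (_∈?_)

    private
      data Route : A → A → List A → Set where
        stop : ∀ {x} → Route x x []
        go   : ∀ {x y z vs} → R x y → Route y z vs → Route x z (x ∷ vs)

      cut-loop : ∀ {x y z vs} → x ∈ vs → Route y z vs → Unique vs → ∃ λ vs′ → Route x z vs′ × Unique vs′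
      cut-loop (here refl) rt@(go _ _) u       = _ , rt , u
      cut-loop (there x∈)  (go _ rt)   (_ ∷ u) = cut-loop x∈ rt u

      simple : ∀ {x y} → Star R x y → ∃ λ vs → Route x y vs × Unique vs
      simple ε = [] , stop , []
      simple {x} (e ◅ p) with simple p
      ... | vs , rt , u with x ∈? vs
      ...   | yes x∈ = cut-loop x∈ rt u
      ...   | no x∉  = x ∷ vs , go e rt , Allₚ.¬Any⇒All¬ vs x∉ ∷ u

      route-⊆ : ∀ {x y vs} → Route x y vs → All (_∈ Ω) vs
      route-⊆ stop      = []
      route-⊆ (go e rt) = R⊆Ω e ∷ route-⊆ rt

      route⇒walk : ∀ {x y vs} → Route x y vs → Walk R (length vs) x y
      route⇒walk stop      = []
      route⇒walk (go e rt) = e ∷ route⇒walk rt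

    -- Cutting out loops bounds the length by the number of possible vertices of the walk; idle
    -- moves then give every larger length.
    shorten : ∀ {x y} → Star R x y → ∃ λ m → (m ≤ length Ω) × Walk R m x y
    shorten p with simple p
    ... | vs , rt , u = length vs , Unique⇒length≤ u (route-⊆ rt) , route⇒walk rt

  pad : ∀ {R : A → A → Set} {m x y} k → R x x → Walk R m x y → Walk R (k + m) x y
  pad zero    e w = w
  pad (suc k) e w = e ∷ pad k e w

  take-++-≤ : ∀ k (xs ys : List A) → k ≤ length xs → take k (xs ++ ys) ≡ take k xs
  take-++-≤ zero    xs       ys _        = refl
  take-++-≤ (suc k) (x ∷ xs) ys (s≤s le) = cong (x ∷_) (take-++-≤ k xs ys le)

  window-++ˡ : ∀ k i (xs ys : List A) → i + k ≤ length xs → take k (drop i (xs ++ ys)) ≡ take k (drop i xs)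
  window-++ˡ k zero    xs       ys le       = take-++-≤ k xs ys le
  window-++ˡ k (suc i) (x ∷ xs) ys (s≤s le) = window-++ˡ k i xs ys le

  drop-++-+ : ∀ i (xs ys : List A) → drop (length xs + i) (xs ++ ys) ≡ drop i ys
  drop-++-+ i []       ys = refl
  drop-++-+ i (x ∷ xs) ys = drop-++-+ i xs ys

  take-++-+ : ∀ k (xs ys : List A) → take (length xs + k) (xs ++ ys) ≡ xs ++ take k ys
  take-++-+ k []       ys = refl
  take-++-+ k (x ∷ xs) ys = cong (x ∷_) (take-++-+ k xs ys)

  window-overlap : ∀ k i (xs ys : List A) → i ≤ length xs → take (length xs + k) (drop i (xs ++ ys)) ≡ drop i xs ++ take (i + k) ys
  window-overlap k zero    xs       ys _        = take-++-+ k xs ys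
  window-overlap k (suc i) (x ∷ xs) ys (s≤s le) = begin
    take (suc (length xs) + k) (drop i (xs ++ ys)) ≡⟨ cong (λ j → take j (drop i (xs ++ ys))) (sym (+-suc (length xs) k)) ⟩
    take (length xs + suc k) (drop i (xs ++ ys))   ≡⟨ window-overlap (suc k) i xs ys le ⟩
    drop i xs ++ take (i + suc k) ys               ≡⟨ cong (λ j → drop i xs ++ take j ys) (+-suc i k) ⟩
    drop i xs ++ take (suc i + k) ys               ∎
    where open ≡-Reasoning

  -- The changed position lies on one side of the cut at `i`; therefore a window straddling two
  -- successive lists of a walk is a rotation of one of the two.
  OneChange-take-drop : ∀ {x y : List A} → OneChange x y → ∀ i → (take i y ≡ take i x) ⊎ (drop i x ≡ drop i y)
  OneChange-take-drop ch         zero    = inj₁ refl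
  OneChange-take-drop here       (suc i) = inj₂ refl
  OneChange-take-drop (there ch) (suc i) with OneChange-take-drop ch i
  ... | inj₁ eq = inj₁ (cong (_ ∷_) eq)
  ... | inj₂ eq = inj₂ eq

  drop++take↭ : ∀ i (x : List A) → x ↭ drop i x ++ take i x
  drop++take↭ i x = trans (↭-reflexive (sym (take++drop≡id i x))) (++-comm (take i x) (drop i x))

-- The windows of w ++ w starting inside the first copy are the cyclic windows of w.
CyclicWord : {V : Set} → ℕ → (List V → Set) → ℕ → List V → Set
CyclicWord r E ℓ w = (length w ≡ ℓ) × (∀ i → i < ℓ → E (take r (drop i (w ++ w))))

module Words {V : Set} (_≟_ : DecidableEquality V) (r : ℕ) (E : List V → Set)
             (E-resp : ∀ {L L′} → L ↭ L′ → E L → E L′) (E-length : ∀ {L} → E L → length L ≡ r) (W : List V) where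

  open Moves E W

  word : ∀ {m f g} → Walk Move m f g → List V
  word []                = []
  word (_∷_ {x = f} _ w) = f ++ word w

  length-word : ∀ {m f g} (w : Walk Move m f g) → length (word w) ≡ m * r
  length-word []                         = refl
  length-word (_∷_ {x = f} (_ , e , _) w) = ≡.trans (length-++ f) (cong₂ _+_ (E-length (proj₁ e)) (length-word w))

  word-⊆ : ∀ {m f g} (w : Walk Move m f g) → All (_∈ W) (word w)
  word-⊆ []                = []
  word-⊆ ((_ , e , _) ∷ w) = Allₚ.++⁺ (proj₂ e) (word-⊆ w)

  starts-with : ∀ {m f g} (w : Walk Move m f g) → ∃ λ t → word w ++ g ++ g ≡ f ++ t
  starts-with {g = g} []              = g , refl
  starts-with {g = g} (_∷_ {x = f} _ w) = word w ++ g ++ g , ++-assoc f (word w) (g ++ g)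

  between : ∀ {f f′} → OneChange f f′ → E f → E f′ → ∀ i → E (drop i f ++ take i f′)
  between {f} {f′} ch e e′ i with OneChange-take-drop ch i
  ... | inj₁ eq = subst (λ t → E (drop i f ++ t)) (sym eq) (E-resp (drop++take↭ i f) e)
  ... | inj₂ eq = subst (λ t → E (t ++ take i f′)) (sym eq) (E-resp (drop++take↭ i f′) e′)

  overlap-window : ∀ {f f′} t → OneChange f f′ → E f → E f′ → ∀ i → i ≤ r → E (take r (drop i (f ++ f′ ++ t)))
  overlap-window {f} {f′} t ch e e′ i i≤r = subst E (sym eq) (between ch e e′ i)
    where
    open ≡-Reasoning
    eq : take r (drop i (f ++ f′ ++ t)) ≡ drop i f ++ take i f′
    eq = begin
      take r (drop i (f ++ f′ ++ t))              ≡⟨ cong (λ j → take j (drop i (f ++ f′ ++ t))) (sym (≡.trans (+-identityʳ _) (E-length e))) ⟩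
      take (length f + 0) (drop i (f ++ f′ ++ t)) ≡⟨ window-overlap 0 i f (f′ ++ t) (subst (i ≤_) (sym (E-length e)) i≤r) ⟩
      drop i f ++ take (i + 0) (f′ ++ t)          ≡⟨ cong (λ j → drop i f ++ take j (f′ ++ t)) (+-identityʳ i) ⟩
      drop i f ++ take i (f′ ++ t)                ≡⟨ cong (drop i f ++_) (take-++-≤ i f′ t (subst (i ≤_) (sym (E-length e′)) i≤r)) ⟩
      drop i f ++ take i f′                       ∎

  word-windows : 1 ≤ r → ∀ {m f g} (w : Walk Move m f g) → E g → ∀ i → i ≤ m * r + r → E (take r (drop i (word w ++ g ++ g)))
  word-windows 1≤r {g = []} [] e i i≤ with E-length e
  ... | refl = ⊥-elim (<-irrefl refl 1≤r)
  word-windows 1≤r {g = g@(_ ∷ _)} [] e i i≤ =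
    subst (λ l → E (take r (drop i (g ++ l)))) (++-identityʳ g) (overlap-window [] here e e i i≤)
  word-windows 1≤r {suc m} {f} {g} (_∷_ {y = f′} (ch , ef , ef′) w) e i i≤ with i ≤? r | starts-with w
  ... | yes i≤r | t , eq = subst (λ l → E (take r (drop i l))) (≡.trans (cong (f ++_) (sym eq)) (sym (++-assoc f (word w) (g ++ g))))
                            (overlap-window t ch (proj₁ ef) (proj₁ ef′) i i≤r)
  ... | no i≰r  | _ = subst (λ l → E (take r l)) (sym eq) (word-windows 1≤r w e (i ∸ r) i∸r≤)
    where
    r≤i : r ≤ i
    r≤i = <⇒≤ (≰⇒> i≰r)
    i∸r≤ : i ∸ r ≤ m * r + r
    i∸r≤ = ≤-trans (∸-monoˡ-≤ r i≤) (≤-reflexive (≡.trans (cong (_∸ r) (+-assoc r (m * r) r)) (m+n∸m≡n r (m * r + r))))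
    eq : drop i ((f ++ word w) ++ g ++ g) ≡ drop (i ∸ r) (word w ++ g ++ g)
    eq = ≡.trans (cong₂ drop (sym (≡.trans (cong (_+ (i ∸ r)) (E-length (proj₁ ef))) (m+[n∸m]≡n r≤i))) (++-assoc f (word w) (g ++ g)))
                 (drop-++-+ (i ∸ r) f (word w ++ g ++ g))

  -- After the final `Z` the cyclic word restarts with G ++ Z, so Z ++ G is read there, exactly
  -- where the walk ends. The doubled word and the unrolled walk agree on the first ℓ + r entries,
  -- which contain every window starting before ℓ.
  closed-word : 1 ≤ r → ∀ {m} Z G → EW (Z ++ G) → Walk Move (suc m) (G ++ Z) (Z ++ G) →
                ∃ λ w → CyclicWord r E (suc m * r + length Z) w × All (_∈ W) w
  closed-word 1≤r {m} Z G e wk@(_∷_ (ch , ef , _) wk′) = w , (len , windows) , Allₚ.++⁺ (word-⊆ wk) (Allₚ.++⁻ˡ Z (proj₂ e))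
    where
    w rest : List V
    w = word wk ++ Z
    rest = word wk′ ++ Z
    ℓ : ℕ
    ℓ = suc m * r + length Z
    len : length w ≡ ℓ
    len = ≡.trans (length-++ (word wk)) (cong (_+ length Z) (length-word wk))
    f : List V
    f = G ++ Z
    eq₁ : word wk ++ (Z ++ G) ++ (Z ++ G) ≡ (w ++ f) ++ G
    eq₁ = begin
      word wk ++ (Z ++ G) ++ (Z ++ G) ≡⟨ cong (word wk ++_) (++-assoc Z G (Z ++ G)) ⟩
      word wk ++ Z ++ G ++ Z ++ G     ≡⟨ cong (λ l → word wk ++ Z ++ l) (sym (++-assoc G Z G)) ⟩
      word wk ++ Z ++ f ++ G          ≡⟨ sym (++-assoc (word wk) Z (f ++ G)) ⟩
      w ++ f ++ G                     ≡⟨ sym (++-assoc w f G) ⟩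
      (w ++ f) ++ G                   ∎
      where open ≡-Reasoning
    eq₂ : w ++ w ≡ (w ++ f) ++ rest
    eq₂ = ≡.trans (cong (w ++_) (++-assoc f (word wk′) Z)) (sym (++-assoc w f rest))
    windows : ∀ i → i < ℓ → E (take r (drop i (w ++ w)))
    windows i i<ℓ = subst E (begin
      take r (drop i (word wk ++ (Z ++ G) ++ (Z ++ G))) ≡⟨ cong (λ l → take r (drop i l)) eq₁ ⟩
      take r (drop i ((w ++ f) ++ G))                   ≡⟨ window-++ˡ r i (w ++ f) G fits ⟩
      take r (drop i (w ++ f))                          ≡⟨ sym (window-++ˡ r i (w ++ f) rest fits) ⟩
      take r (drop i ((w ++ f) ++ rest))                ≡⟨ cong (λ l → take r (drop i l)) (sym eq₂) ⟩
      take r (drop i (w ++ w))                          ∎)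
      (word-windows 1≤r wk (proj₁ e) i (≤-trans (<⇒≤ i<ℓ) (+-monoʳ-≤ (suc m * r) |Z|≤r)))
      where
      open ≡-Reasoning
      |Z|≤r : length Z ≤ r
      |Z|≤r = ≤-trans (m≤m+n (length Z) (length G)) (≤-reflexive (≡.trans (sym (length-++ Z)) (E-length (proj₁ e))))
      fits : i + r ≤ length (w ++ f)
      fits = ≤-trans (+-monoˡ-≤ r (<⇒≤ i<ℓ)) (≤-reflexive (sym (≡.trans (length-++ w) (cong₂ _+_ len (E-length (proj₁ ef))))))

  rotation⇒word : 1 ≤ r → ∀ {m} Z G → EW (Z ++ G) → Star Move (G ++ Z) (Z ++ G) → length W ^ r < m →
                  ∃ λ w → CyclicWord r E (m * r + length Z) w × All (_∈ W) w
  rotation⇒word 1≤r {suc m} Z G e p (s≤s bound) = build (shorten (≡-dec _≟_) Move (lists r W) R⊆Ω p)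
    where
    R⊆Ω : ∀ {L M} → Move L M → L ∈ lists r W
    R⊆Ω {L} (_ , (eL , a) , _) = subst (λ k → L ∈ lists k W) (E-length eL) (∈-lists L a)
    ef : EW (G ++ Z)
    ef = E-resp (++-comm Z G) (proj₁ e) , All-resp-↭ (++-comm Z G) (proj₂ e)
    stay : ∀ L → EW L → Move L L
    stay []      eL with E-length (proj₁ eL)
    ... | refl = ⊥-elim (<-irrefl refl 1≤r)
    stay (_ ∷ _) eL = here , eL , eL
    build : (∃ λ k → (k ≤ length (lists r W)) × Walk Move k (G ++ Z) (Z ++ G)) → _
    build (k , k≤ , wk) = closed-word 1≤r Z G e
      (subst (λ j → Walk Move j (G ++ Z) (Z ++ G)) (m∸n+n≡m k≤m) (pad (suc m ∸ k) (stay (G ++ Z) ef) wk))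
      where
      k≤m : k ≤ suc m
      k≤m = ≤-trans k≤ (≤-trans (≤-reflexive (length-lists r W)) (≤-trans bound (n≤1+n m)))

-- Lists as vertex sets

setOf : ∀ {n} → List (Fin n) → Subset n
setOf = foldr (λ x p → ⁅ x ⁆ ∪ p) ∅

setOf-↭ : ∀ {n} {L L′ : List (Fin n)} → L ↭ L′ → setOf L ≡ setOf L′
setOf-↭ refl         = refl
setOf-↭ (prep x p)   = cong (⁅ x ⁆ ∪_) (setOf-↭ p)
setOf-↭ (swap x y p) = ≡.trans (cong (λ q → ⁅ x ⁆ ∪ (⁅ y ⁆ ∪ q)) (setOf-↭ p)) (≡.trans (sym (∪-assoc ⁅ x ⁆ ⁅ y ⁆ _))
                       (≡.trans (cong (_∪ _) (∪-comm ⁅ x ⁆ ⁅ y ⁆)) (∪-assoc ⁅ y ⁆ ⁅ x ⁆ _)))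
setOf-↭ (trans p q)  = ≡.trans (setOf-↭ p) (setOf-↭ q)

∈-setOf⁺ : ∀ {n} {v : Fin n} {L} → v ∈ L → v ∈ˢ setOf L
∈-setOf⁺ (here refl) = x∈p∪q⁺ (inj₁ (x∈⁅x⁆ _))
∈-setOf⁺ (there v∈)  = x∈p∪q⁺ (inj₂ (∈-setOf⁺ v∈))

∈-setOf⁻ : ∀ {n} {v : Fin n} L → v ∈ˢ setOf L → v ∈ L
∈-setOf⁻ []      v∈ = ⊥-elim (∉⊥ v∈)
∈-setOf⁻ (x ∷ L) v∈ with x∈p∪q⁻ ⁅ x ⁆ (setOf L) v∈
... | inj₁ h = here (x∈⁅y⁆⇒x≡y x h)
... | inj₂ h = there (∈-setOf⁻ L h)

∣⁅x⁆∪p∣ : ∀ {n} (x : Fin n) (p : Subset n) → x ∉ˢ p → ∣ ⁅ x ⁆ ∪ p ∣ ≡ suc ∣ p ∣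
∣⁅x⁆∪p∣ fzero    (true  ∷ p) x∉ = ⊥-elim (x∉ here)
∣⁅x⁆∪p∣ fzero    (false ∷ p) x∉ = cong (λ q → suc ∣ q ∣) (∪-identityˡ p)
∣⁅x⁆∪p∣ (fsuc x) (true  ∷ p) x∉ = cong suc (∣⁅x⁆∪p∣ x p (x∉ ∘ there))
∣⁅x⁆∪p∣ (fsuc x) (false ∷ p) x∉ = ∣⁅x⁆∪p∣ x p (x∉ ∘ there)

∣setOf∣ : ∀ {n} {L : List (Fin n)} → Unique L → ∣ setOf L ∣ ≡ length L
∣setOf∣ {n} []   = ∣⊥∣≡0 n
∣setOf∣ {L = x ∷ L} (x≢ ∷ u) = ≡.trans (∣⁅x⁆∪p∣ x (setOf L) (λ h → Allₚ.All¬⇒¬Any x≢ (∈-setOf⁻ L h))) (cong suc (∣setOf∣ u))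

∣tabulate∣ : ∀ {n} (A : Fin n → Bool) → ∣ tabulate A ∣ ≡ count A
∣tabulate∣ {zero}  A = refl
∣tabulate∣ {suc n} A with A fzero
... | true  = cong suc (∣tabulate∣ (A ∘ fsuc))
... | false = ∣tabulate∣ (A ∘ fsuc)

_∈?_ : ∀ {n} (z : Fin n) (ws : List (Fin n)) → Dec (z ∈ ws)
z ∈? ws = any? (z ≟ᶠ_) ws

count-∈ : ∀ {n} (ws : List (Fin n)) → count (λ z → does (z ∈? ws)) ≤ length ws
count-∈ {n} ws = ≤-trans (≤-reflexive (sym (≡.trans (length-map proj₁ J) (count-collect id f))))
  (Unique⇒length≤ (Unique-⊆ (collect-⊆ f (allFin n)) (Uniqueₚ.allFin⁺ n)) (Allₚ.map⁺ (All.universal inside J)))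
  where
  f : Fin n → Bool
  f z = does (z ∈? ws)
  J : List (Σ (Fin n) λ z → f z ≡ true)
  J = collect f (allFin n)
  inside : ∀ (i : Σ (Fin n) λ z → f z ≡ true) → proj₁ i ∈ ws
  inside (z , eq) with z ∈? ws
  ... | yes z∈ = z∈

-- Collecting the vertices

-- The number of triples of lists of length r - 1 over m vertices; each triple receives a vertex of
-- its own.
jobCount : ℕ → ℕ → ℕ
jobCount r m = m ^ (r ∸ 1) * (m ^ (r ∸ 1) * m ^ (r ∸ 1))

-- The number of vertices added to m given ones: two rounds for every unit of the chain, and a last
-- round for the exchange paths.
growth : ℕ → ℕ → ℕ → ℕ
growth r zero    m = jobCount r m
growth r (suc d) m = jobCount r m + (jobCount r m₁ + growth r d (m₁ + jobCount r m₁))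
  where
  m₁ : ℕ
  m₁ = m + jobCount r m

worldSize : ℕ → ℕ
worldSize r = (r ∸ 1) + growth r (suc r) (r ∸ 1)

module World {n : ℕ} (H : Hypergraph n) (r : ℕ) where

  E : List (Fin n) → Set
  E L = Unique L × (length L ≡ r) × (edge H (setOf L) ≡ true)

  E? : ∀ L → Dec (E L)
  E? L = allPairs? (λ x y → ¬? (x ≟ᶠ y)) L ×-dec (length L ℕ.≟ r) ×-dec (edge H (setOf L) Boolₚ.≟ true)

  E-resp : ∀ {L L′} → L ↭ L′ → E L → E L′
  E-resp p (u , l , e) = Unique-resp-↭ p u , ≡.trans (sym (↭-length p)) l , ≡.trans (cong (edge H) (sym (setOf-↭ p))) e

  E-unique : ∀ {L} → E L → Unique L
  E-unique = proj₁

  E-length : ∀ {L} → E L → length L ≡ r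
  E-length = proj₁ ∘ proj₂

  open Common _≟ᶠ_ r E public

  neighbour : List (Fin n) → Fin n → Bool
  neighbour S z = not (lookup (setOf S) z) ∧ edge H (setOf S ∪ ⁅ z ⁆)

  neighbour⇒E : ∀ {S z} → Unique S → suc (length S) ≡ r → neighbour S z ≡ true → E (z ∷ S)
  neighbour⇒E {S} {z} u len eq with lookup (setOf S) z in l
  ... | false = Allₚ.¬Any⇒All¬ S (λ z∈ → true≢false (≡.trans (sym ([]=⇒lookup (∈-setOf⁺ z∈))) l)) ∷ u , len ,
                ≡.trans (cong (edge H) (∪-comm ⁅ z ⁆ (setOf S))) eq

  module Build (t : ℕ) (1≤t : 1 ≤ t)
               (codegree : ∀ S → ∣ S ∣ + 1 ≡ r → ¬ (codeg H S * (3 * t) ≤ (t + 3) * n))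
               (M : ℕ) (large : 2 * t * M ≤ n) where

    C : ℕ
    C = 2 * t

    -- At most M vertices are discarded, and n ≥ 2 t M makes this at most half of n / t.
    fresh : ∀ (A : Fin n → Bool) ws → length ws ≤ M → n ≤ t * count A → Many C (λ z → (A z ≡ true) × (z ∉ ws))
    fresh A ws ws≤M big = B , n≤ , sound
      where
      B : Fin n → Bool
      B z = A z ∧ not (does (z ∈? ws))
      sound : ∀ z → B z ≡ true → (A z ≡ true) × (z ∉ ws)
      sound z eq with A z | z ∈? ws
      ... | true  | no z∉ = refl , z∉
      split : count A ≤ count B + length ws
      split = ≤-trans (sum-mono pointwise) (≤-trans (≤-reflexive (∑-distrib-+ {n} _ _)) (+-monoʳ-≤ (count B) (count-∈ ws)))
        where
        pointwise : ∀ z → bit (A z) ≤ bit (B z) + bit (does (z ∈? ws))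
        pointwise z with A z | does (z ∈? ws)
        ... | true  | true  = ≤-refl
        ... | true  | false = ≤-refl
        ... | false | _     = z≤n
      n≤ : n ≤ C * count B
      n≤ = +-cancelʳ-≤ n n _ (begin
        n + n                                ≤⟨ +-mono-≤ big big ⟩
        t * count A + t * count A            ≤⟨ +-mono-≤ (*-monoʳ-≤ t split) (*-monoʳ-≤ t split) ⟩
        t * (count B + length ws) + t * (count B + length ws) ≡⟨ arith t (count B) (length ws) ⟩
        2 * t * count B + 2 * t * length ws  ≤⟨ +-monoʳ-≤ (2 * t * count B) (≤-trans (*-monoʳ-≤ (2 * t) ws≤M) large) ⟩
        2 * t * count B + n                  ∎)
        where
        open ≤-Reasoning
        open +-*-Solver
        arith : ∀ a b c → a * (b + c) + a * (b + c) ≡ 2 * a * b + 2 * a * c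
        arith = solve 3 (λ a b c → a :* (b :+ c) :+ a :* (b :+ c) := con 2 :* a :* b :+ con 2 :* a :* c) refl

    big-neighbourhood : ∀ {S} → Unique S → suc (length S) ≡ r → (t + 3) * n < count (neighbour S) * (3 * t)
    big-neighbourhood {S} u len = ≰⇒> (λ le → codegree (setOf S) (≡.trans (+-comm _ 1) (≡.trans (cong suc (∣setOf∣ u)) len))
      (subst (λ k → k * (3 * t) ≤ (t + 3) * n) (sym (∣tabulate∣ (neighbour S))) le))

    inclusion-exclusion : ∀ (A₁ A₂ A₃ : Fin n → Bool) → count A₁ + count A₂ + count A₃ ≤
      n * 1 + (count (λ z → A₁ z ∧ A₂ z) + count (λ z → A₁ z ∧ A₃ z) + count (λ z → A₂ z ∧ A₃ z))
    inclusion-exclusion A₁ A₂ A₃ = begin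
      count A₁ + count A₂ + count A₃                                   ≡⟨ sym (sum₃ (bit ∘ A₁) (bit ∘ A₂) (bit ∘ A₃)) ⟩
      sum (λ z → bit (A₁ z) + bit (A₂ z) + bit (A₃ z))                 ≤⟨ sum-mono (λ z → pointwise (A₁ z) (A₂ z) (A₃ z)) ⟩
      sum (λ z → 1 + (b₁₂ z + b₁₃ z + b₂₃ z))                          ≡⟨ ∑-distrib-+ {n} _ _ ⟩
      sum {n} (λ _ → 1) + sum (λ z → b₁₂ z + b₁₃ z + b₂₃ z)            ≡⟨ cong₂ _+_ (sum-const n 1) (sum₃ b₁₂ b₁₃ b₂₃) ⟩
      n * 1 + (sum b₁₂ + sum b₁₃ + sum b₂₃)                            ∎
      where
      open ≤-Reasoning
      b₁₂ b₁₃ b₂₃ : Fin n → ℕ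
      b₁₂ z = bit (A₁ z ∧ A₂ z)
      b₁₃ z = bit (A₁ z ∧ A₃ z)
      b₂₃ z = bit (A₂ z ∧ A₃ z)
      sum₃ : ∀ (f g h : Fin n → ℕ) → sum (λ z → f z + g z + h z) ≡ sum f + sum g + sum h
      sum₃ f g h = ≡.trans (∑-distrib-+ {n} _ _) (cong (_+ sum h) (∑-distrib-+ {n} f g))
      pointwise : ∀ a b c → bit a + bit b + bit c ≤ 1 + (bit (a ∧ b) + bit (a ∧ c) + bit (b ∧ c))
      pointwise true  true  true  = s≤s (s≤s (s≤s z≤n))
      pointwise true  true  false = ≤-refl
      pointwise true  false true  = ≤-refl
      pointwise true  false false = ≤-refl
      pointwise false true  true  = ≤-refl
      pointwise false true  false = ≤-refl
      pointwise false false true  = ≤-refl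
      pointwise false false false = z≤n

    -- Three sets larger than (1/3 + 1/t) n have total size above n + 3n/t, so their pairwise
    -- intersections exceed 3n/t together and one of them has at least n/t elements. This is where
    -- 1/3 enters.
    one-of-three : ∀ a₁ a₂ a₃ x y z → (t + 3) * n < a₁ * (3 * t) → (t + 3) * n < a₂ * (3 * t) → (t + 3) * n < a₃ * (3 * t) →
                   a₁ + a₂ + a₃ ≤ n * 1 + (x + y + z) → (n ≤ t * x) ⊎ (n ≤ t * y) ⊎ (n ≤ t * z)
    one-of-three a₁ a₂ a₃ x y z h₁ h₂ h₃ incl with n ≤? t * x | n ≤? t * y | n ≤? t * z
    ... | yes p | _     | _     = inj₁ p
    ... | no _  | yes p | _     = inj₂ (inj₁ p)
    ... | no _  | no _  | yes p = inj₂ (inj₂ p)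
    ... | no p  | no q  | no s  = ⊥-elim (<-irrefl refl (begin-strict
      (t + 3) * n + (t + 3) * n + (t + 3) * n              <⟨ +-mono-< (+-mono-< h₁ h₂) h₃ ⟩
      a₁ * (3 * t) + a₂ * (3 * t) + a₃ * (3 * t)           ≡⟨ solve 4 (λ a b c d → a :* d :+ b :* d :+ c :* d := (a :+ b :+ c) :* d) refl a₁ a₂ a₃ (3 * t) ⟩
      (a₁ + a₂ + a₃) * (3 * t)                             ≤⟨ *-monoˡ-≤ (3 * t) incl ⟩
      (n * 1 + (x + y + z)) * (3 * t)                      ≡⟨ solve 5 (λ m a b c d → (m :* con 1 :+ (a :+ b :+ c)) :* (con 3 :* d) := con 3 :* d :* m :+ con 3 :* (d :* a :+ d :* b :+ d :* c)) refl n x y z t ⟩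
      3 * t * n + 3 * (t * x + t * y + t * z)              ≤⟨ +-monoʳ-≤ (3 * t * n) (*-monoʳ-≤ 3 (+-mono-≤ (+-mono-≤ (<⇒≤ (≰⇒> p)) (<⇒≤ (≰⇒> q))) (<⇒≤ (≰⇒> s)))) ⟩
      3 * t * n + 3 * (n + n + n)                          ≡⟨ solve 2 (λ m d → con 3 :* d :* m :+ con 3 :* (m :+ m :+ m) := (d :+ con 3) :* m :+ (d :+ con 3) :* m :+ (d :+ con 3) :* m) refl n t ⟩
      (t + 3) * n + (t + 3) * n + (t + 3) * n              ∎))
      where
      open ≤-Reasoning
      open +-*-Solver

    Valid : List (Fin n) → Set
    Valid S = Unique S × (suc (length S) ≡ r)

    valid? : ∀ S → Dec (Valid S)
    valid? S = allPairs? (λ x y → ¬? (x ≟ᶠ y)) S ×-dec (suc (length S) ℕ.≟ r)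

    Job : Set
    Job = List (Fin n) × List (Fin n) × List (Fin n)

    Serves : Job → Fin n → Set
    Serves (S₁ , S₂ , S₃) z = Valid S₁ → Valid S₂ → Valid S₃ → TwoOf z S₁ S₂ S₃

    private
      ∧-true : ∀ {a b} → a ∧ b ≡ true → (a ≡ true) × (b ≡ true)
      ∧-true {true} {true} _ = refl , refl

    serve-valid : ∀ {S₁ S₂ S₃} ws → length ws ≤ M → Valid S₁ → Valid S₂ → Valid S₃ → Many C (λ z → TwoOf z S₁ S₂ S₃ × (z ∉ ws))
    serve-valid {S₁} {S₂} {S₃} ws ws≤M (u₁ , l₁) (u₂ , l₂) (u₃ , l₃)
      with one-of-three (count (neighbour S₁)) (count (neighbour S₂)) (count (neighbour S₃)) _ _ _ (big-neighbourhood u₁ l₁) (big-neighbourhood u₂ l₂) (big-neighbourhood u₃ l₃)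
             (inclusion-exclusion (neighbour S₁) (neighbour S₂) (neighbour S₃))
    ... | inj₁ big        = Many-map C (λ { z (eq , z∉) → inj₁ (neighbour⇒E u₁ l₁ (proj₁ (∧-true eq)) , neighbour⇒E u₂ l₂ (proj₂ (∧-true {neighbour S₁ z} eq))) , z∉ }) (fresh _ ws ws≤M big)
    ... | inj₂ (inj₁ big) = Many-map C (λ { z (eq , z∉) → inj₂ (inj₁ (neighbour⇒E u₁ l₁ (proj₁ (∧-true eq)) , neighbour⇒E u₃ l₃ (proj₂ (∧-true {neighbour S₁ z} eq)))) , z∉ }) (fresh _ ws ws≤M big)
    ... | inj₂ (inj₂ big) = Many-map C (λ { z (eq , z∉) → inj₂ (inj₂ (neighbour⇒E u₂ l₂ (proj₁ (∧-true eq)) , neighbour⇒E u₃ l₃ (proj₂ (∧-true {neighbour S₂ z} eq)))) , z∉ }) (fresh _ ws ws≤M big)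

    anything : ∀ ws → length ws ≤ M → Many C (λ z → (true ≡ true) × (z ∉ ws))
    anything ws ws≤M = fresh (λ _ → true) ws ws≤M
      (≤-trans (≤-reflexive (sym (≡.trans (sum-const n 1) (*-identityʳ n)))) (m≤n*m _ t {{ℕ.>-nonZero 1≤t}}))

    -- A triple that is not admissible still consumes a vertex, any fresh one, so that the number of
    -- choices depends only on the length of `ws`.
    serve : ∀ j ws → length ws ≤ M → Many C (λ z → Serves j z × (z ∉ ws))
    serve (S₁ , S₂ , S₃) ws ws≤M with valid? S₁ | valid? S₂ | valid? S₃
    ... | yes v₁ | yes v₂ | yes v₃ = Many-map C (λ { z (two , z∉) → (λ _ _ _ → two) , z∉ }) (serve-valid ws ws≤M v₁ v₂ v₃)
    ... | no ¬v₁ | _      | _      = Many-map C (λ { z (_ , z∉) → (λ v _ _ → ⊥-elim (¬v₁ v)) , z∉ }) (anything ws ws≤M)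
    ... | yes _  | no ¬v₂ | _      = Many-map C (λ { z (_ , z∉) → (λ _ v _ → ⊥-elim (¬v₂ v)) , z∉ }) (anything ws ws≤M)
    ... | yes _  | yes _  | no ¬v₃ = Many-map C (λ { z (_ , z∉) → (λ _ _ v → ⊥-elim (¬v₃ v)) , z∉ }) (anything ws ws≤M)

    Unique-∷ʳ : ∀ {z} {ws : List (Fin n)} → Unique ws → z ∉ ws → Unique (ws ++ z ∷ [])
    Unique-∷ʳ {z} {ws} u z∉ = Unique-resp-↭ (++-comm (z ∷ []) ws) (Allₚ.¬Any⇒All¬ ws z∉ ∷ u)

    serve-all : ∀ js ws → Unique ws → length ws + length js ≤ M →
                Ample C (length js) (λ l → Unique (ws ++ l) × All (λ j → Any (Serves j) l) js)
    serve-all []       ws u le = subst Unique (sym (++-identityʳ ws)) u , []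
    serve-all (j ∷ js) ws u le = Many-map C next (serve j ws (≤-trans (m≤m+n _ _) le))
      where
      next : ∀ z → Serves j z × (z ∉ ws) → Ample C (length js) (λ l → Unique (ws ++ z ∷ l) × All (λ j → Any (Serves j) (z ∷ l)) (j ∷ js))
      next z (srv , z∉) = Ample-map (length js)
        (λ { l _ (u′ , a) → subst Unique (++-assoc ws (z ∷ []) l) u′ , here srv ∷ All.map there a })
        (serve-all js (ws ++ z ∷ []) (Unique-∷ʳ u z∉)
          (≤-trans (≤-reflexive (≡.trans (cong (_+ length js) (length-++ ws)) (+-assoc (length ws) 1 (length js)))) le))

    jobs : List (Fin n) → List Job
    jobs ws = cartesianProduct Ss (cartesianProduct Ss Ss)
      where
      Ss : List (List (Fin n))
      Ss = lists (r ∸ 1) ws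

    Unique-++-∉ : ∀ {z} ws {l : List (Fin n)} → Unique (ws ++ l) → z ∈ l → z ∉ ws
    Unique-++-∉ (w ∷ ws) (h ∷ u) z∈ (here refl) = All.lookup h (∈-++⁺ʳ ws z∈) refl
    Unique-++-∉ (w ∷ ws) (h ∷ u) z∈ (there z∈′) = Unique-++-∉ ws u z∈ z∈′

    served⇒Closed : ∀ ws l → Unique (ws ++ l) → All (λ j → Any (Serves j) l) (jobs ws) → Closed ws (ws ++ l)
    served⇒Closed ws l u a S₁ S₂ S₃ adm₁ adm₂ adm₃
      with find (All.lookup a (∈-cartesianProduct⁺ (listed adm₁) (∈-cartesianProduct⁺ (listed adm₂) (listed adm₃))))
      where
      listed : ∀ {S} → Admissible ws S → S ∈ lists (r ∸ 1) ws
      listed {S} (S⊆ , _ , len) = subst (λ k → S ∈ lists k ws) (cong (_∸ 1) len) (∈-lists S S⊆)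
    ... | z , z∈ , srv = z , ∈-++⁺ʳ ws z∈ , Unique-++-∉ ws u z∈ , srv (proj₂ adm₁) (proj₂ adm₂) (proj₂ adm₃)

    length-jobs : ∀ ws → length (jobs ws) ≡ jobCount r (length ws)
    length-jobs ws = ≡.trans (length-product _,_ Ss (cartesianProduct Ss Ss))
      (cong₂ _*_ (length-lists (r ∸ 1) ws) (≡.trans (length-product _,_ Ss Ss) (cong₂ _*_ (length-lists (r ∸ 1) ws) (length-lists (r ∸ 1) ws))))
      where
      Ss : List (List (Fin n))
      Ss = lists (r ∸ 1) ws

    round : ∀ m ws → length ws ≡ m → Unique ws → m + jobCount r m ≤ M →
            Ample C (jobCount r m) (λ l → Unique (ws ++ l) × Closed ws (ws ++ l))
    round .(length ws) ws refl u le = subst (λ k → Ample C k (λ l → Unique (ws ++ l) × Closed ws (ws ++ l))) (length-jobs ws)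
      (Ample-map (length (jobs ws)) (λ { l _ (u′ , a) → u′ , served⇒Closed ws l u′ a })
        (serve-all (jobs ws) ws u (subst (λ k → length ws + k ≤ M) (sym (length-jobs ws)) le)))

    -- The descent takes place inside `X`; the surrounding `W` contains the common neighbours needed
    -- to exchange vertices of edges in `X`.
    Tower : ℕ → List (Fin n) → List (Fin n) → Set
    Tower d ws W = ∃ λ X → Chain X ws d × Closed X W × (∀ {u} → u ∈ X → u ∈ W) × Unique W

    tower : ∀ d m ws → length ws ≡ m → Unique ws → m + growth r d m ≤ M → Ample C (growth r d m) (λ l → Tower d ws (ws ++ l))
    tower zero m ws eq u le = Ample-map (jobCount r m) (λ { l _ (u′ , cl) → ws , stop id , cl , (λ {_} → ∈-++⁺ˡ) , u′ }) (round m ws eq u le)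
    tower (suc d) m ws eq u le = Ample-bind (jobCount r m) _ (round m ws eq u le₁) λ { l₁ eq₁ (u₁ , cl₁) →
      let len₁ = ≡.trans (length-++ ws) (cong₂ _+_ eq eq₁) in
      Ample-bind (jobCount r m₁) _ (round m₁ (ws ++ l₁) len₁ u₁ le₂) λ { l₂ eq₂ (u₂ , cl₂) →
        let len₂ = ≡.trans (length-++ (ws ++ l₁)) (cong₂ _+_ len₁ eq₂) in
        Ample-map (growth r d (m₁ + jobCount r m₁))
          (λ { l₃ _ (X , ch , cl₃ , X⊆ , u₃) → let assoc = assoc₃ l₁ l₂ l₃ in
            X , more cl₁ ∈-++⁺ˡ cl₂ ∈-++⁺ˡ ch , subst (Closed X) assoc cl₃ , (λ {u} u∈ → subst (u ∈_) assoc (X⊆ u∈)) , subst Unique assoc u₃ })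
          (tower d (m₁ + jobCount r m₁) ((ws ++ l₁) ++ l₂) len₂ u₂ le₃) } }
      where
      m₁ rest : ℕ
      m₁ = m + jobCount r m
      rest = growth r d (m₁ + jobCount r m₁)
      le₃ : m₁ + jobCount r m₁ + rest ≤ M
      le₃ = ≤-trans (≤-reflexive (≡.trans (+-assoc m₁ (jobCount r m₁) rest) (+-assoc m (jobCount r m) (jobCount r m₁ + rest)))) le
      le₂ : m₁ + jobCount r m₁ ≤ M
      le₂ = ≤-trans (m≤m+n _ rest) le₃
      le₁ : m + jobCount r m ≤ M
      le₁ = ≤-trans (m≤m+n _ (jobCount r m₁)) le₂
      assoc₃ : ∀ l₁ l₂ l₃ → ((ws ++ l₁) ++ l₂) ++ l₃ ≡ ws ++ l₁ ++ l₂ ++ l₃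
      assoc₃ l₁ l₂ l₃ = ≡.trans (++-assoc (ws ++ l₁) l₂ l₃) (++-assoc ws l₁ (l₂ ++ l₃))

    world : 1 ≤ r → worldSize r ≤ M → Ample C (worldSize r) (λ W → ∃ λ ws → Admissible ws ws × Tower (suc r) ws W)
    world 1≤r le = Ample-bind (r ∸ 1) _ start λ { ws len u →
        Ample-map (growth r (suc r) (r ∸ 1)) (λ l _ tw → ws , (All.tabulate id , u , ≡.trans (cong suc len) (m+[n∸m]≡n 1≤r)) , tw)
          (tower (suc r) (r ∸ 1) ws len u le) }
      where
      -- Dummy jobs, whose purpose is to pick r - 1 distinct vertices.
      js : List Job
      js = replicate (r ∸ 1) ([] , [] , [])
      start : Ample C (r ∸ 1) Unique
      start = subst (λ k → Ample C k Unique) (length-replicate (r ∸ 1))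
        (Ample-map (length js) (λ _ _ → proj₁) (serve-all js [] [] (≤-trans (≤-reflexive (length-replicate (r ∸ 1))) (≤-trans (m≤m+n (r ∸ 1) _) le))))

module _ {n : ℕ} (H : Hypergraph n) (r : ℕ) where

  open World H r

  closed-walk : ∀ {q d k p ws X W m} → 1 ≤ r → r ≡ d * q → q ≡ suc (p * 2) → k ≤ q →
                Chain X ws (suc r) → Admissible ws ws → Closed X W → (∀ {u} → u ∈ X → u ∈ W) → length W ^ r < m →
                ¬ ¬ (∃ λ w → CyclicWord r E (m * r + k * d) w × All (_∈ W) w)
  closed-walk {q} {d} {k} {p} {ws} {X} {W} {m} 1≤r r≡ q≡ k≤q ch adm cl X⊆W m> none =
    ¬¬-decidable X r JoinedHead (λ dec → contradiction (λ u v R e → dec (u ∷ v ∷ R) (E-length (proj₁ e)) (proj₂ e)))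
    where
    open Paths _≟ᶠ_ r E E-resp E-unique E-length E? X W X⊆W using (Joined; EX; module Separation)
    open Words _≟ᶠ_ r E E-resp E-length W using (rotation⇒word)
    JoinedHead : List (Fin n) → Set
    JoinedHead (u ∷ v ∷ R) = Joined u v R
    JoinedHead _           = ⊤
    contradiction : (∀ u v R → EX (u ∷ v ∷ R) → Dec (Joined u v R)) → ⊥
    contradiction joined? = no-chain q noBalanced p q≡ (divides d r≡) ch adm
      where
      open Separation cl joined?
      noBalanced : ∀ {x F s} → State X x F s → q ∣ trues s F → ⊥
      noBalanced st q∣ = use (balanced⇒rotation q d k r≡ (subst (1 ≤_) (sym q≡) (s≤s z≤n)) k≤q st q∣)
        where
        use : _ → ⊥
        use (Z , G , len , e , path) = none (subst (λ j → ∃ λ w → CyclicWord r E (m * r + j) w × All (_∈ W) w) len (rotation⇒word 1≤r Z G e path m>))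

-- Embedding the cycle

nth : {A : Set} → A → List A → ℕ → A
nth d []       _       = d
nth d (x ∷ xs) zero    = x
nth d (x ∷ xs) (suc i) = nth d xs i

data At {A : Set} : List A → ℕ → A → Set where
  here  : ∀ {v W} → At (v ∷ W) zero v
  there : ∀ {u v W a} → At W a v → At (u ∷ W) (suc a) v

module _ {A : Set} where

  applyUpTo-cong : ∀ {f g : ℕ → A} k → (∀ j → j < k → f j ≡ g j) → applyUpTo f k ≡ applyUpTo g k
  applyUpTo-cong zero    h = refl
  applyUpTo-cong (suc k) h = cong₂ _∷_ (h 0 (s≤s z≤n)) (applyUpTo-cong k (λ j j< → h (suc j) (s≤s j<)))

  map-applyUpTo : ∀ {B : Set} (f : B → A) (p : ℕ → B) k → map f (applyUpTo p k) ≡ applyUpTo (f ∘ p) k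
  map-applyUpTo f p zero    = refl
  map-applyUpTo f p (suc k) = cong (f (p 0) ∷_) (map-applyUpTo f (p ∘ suc) k)

  window-nth : ∀ d k i (xs : List A) → i + k ≤ length xs → take k (drop i xs) ≡ applyUpTo (λ j → nth d xs (i + j)) k
  window-nth d zero    zero    xs       le       = refl
  window-nth d (suc k) zero    (x ∷ xs) (s≤s le) = cong (x ∷_) (window-nth d k zero xs le)
  window-nth d zero    (suc i) (x ∷ xs) (s≤s le) = refl
  window-nth d (suc k) (suc i) (x ∷ xs) (s≤s le) = window-nth d (suc k) i xs le

  nth-++ˡ : ∀ d (xs ys : List A) i → i < length xs → nth d (xs ++ ys) i ≡ nth d xs i
  nth-++ˡ d (x ∷ xs) ys zero    _        = refl
  nth-++ˡ d (x ∷ xs) ys (suc i) (s≤s le) = nth-++ˡ d xs ys i le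

  nth-++ʳ : ∀ d (xs ys : List A) i → nth d (xs ++ ys) (length xs + i) ≡ nth d ys i
  nth-++ʳ d []       ys i = refl
  nth-++ʳ d (x ∷ xs) ys i = nth-++ʳ d xs ys i

  nth-double : ∀ d (w : List A) ℓ .{{_ : NonZero ℓ}} m → length w ≡ ℓ → m < ℓ + ℓ → nth d (w ++ w) m ≡ nth d w (m % ℓ)
  nth-double d w .(length w) m refl m<2ℓ with m <? length w
  ... | yes m<ℓ = ≡.trans (nth-++ˡ d w w m m<ℓ) (cong (nth d w) (sym (m<n⇒m%n≡m m<ℓ)))
  ... | no m≮ℓ  = begin
    nth d (w ++ w) m               ≡⟨ cong (nth d (w ++ w)) (sym m≡) ⟩
    nth d (w ++ w) (length w + i)  ≡⟨ nth-++ʳ d w w i ⟩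
    nth d w i                      ≡⟨ cong (nth d w) (sym (m<n⇒m%n≡m i<ℓ)) ⟩
    nth d w (i % length w)         ≡⟨ cong (nth d w) (sym ([m+n]%n≡m%n i (length w))) ⟩
    nth d w ((i + length w) % length w) ≡⟨ cong (λ j → nth d w (j % length w)) (≡.trans (+-comm i (length w)) m≡) ⟩
    nth d w (m % length w)         ∎
    where
    open ≡-Reasoning
    i : ℕ
    i = m ∸ length w
    m≡ : length w + i ≡ m
    m≡ = m+[n∸m]≡n (≮⇒≥ m≮ℓ)
    i<ℓ : i < length w
    i<ℓ = +-cancelˡ-< (length w) i (length w) (subst (_< length w + length w) (sym m≡) m<2ℓ)

  nth-∈ : ∀ d (xs : List A) i → i < length xs → nth d xs i ∈ xs
  nth-∈ d (x ∷ xs) zero    _        = here refl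
  nth-∈ d (x ∷ xs) (suc i) (s≤s le) = there (nth-∈ d xs i le)

  nth-All : ∀ {P : A → Set} {d xs} → All P xs → ∀ i → i < length xs → P (nth d xs i)
  nth-All (p ∷ ps) zero    _        = p
  nth-All (p ∷ ps) (suc i) (s≤s le) = nth-All ps i le

  nth-injective : ∀ {d} {xs : List A} → Unique xs → ∀ i j → i < length xs → j < length xs → nth d xs i ≡ nth d xs j → i ≡ j
  nth-injective (h ∷ u) zero    zero    _ _ _ = refl
  nth-injective {d} {x ∷ xs} (h ∷ u) zero    (suc j) _ (s≤s lj) eq = ⊥-elim (All.lookup h (nth-∈ d xs j lj) eq)
  nth-injective {d} {x ∷ xs} (h ∷ u) (suc i) zero    (s≤s li) _ eq = ⊥-elim (All.lookup h (nth-∈ d xs i li) (sym eq))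
  nth-injective (h ∷ u) (suc i) (suc j) (s≤s li) (s≤s lj) eq = cong suc (nth-injective u i j li lj eq)

  pointwise-nth : ∀ {B : Set} {R : A → B → Set} {d d′ xs ys} → Pointwise R xs ys → ∀ j → j < length xs → R (nth d xs j) (nth d′ ys j)
  pointwise-nth (p ∷ ps) zero    _        = p
  pointwise-nth (p ∷ ps) (suc j) (s≤s le) = pointwise-nth ps j le

  At-∈ : ∀ {W : List A} {a v} → At W a v → v ∈ W
  At-∈ here      = here refl
  At-∈ (there p) = there (At-∈ p)

  At-injective : ∀ {W : List A} {a b v} → Unique W → At W a v → At W b v → a ≡ b
  At-injective _       here      here      = refl
  At-injective (h ∷ _) here      (there q) = ⊥-elim (All.lookup h (At-∈ q) refl)
  At-injective (h ∷ _) (there p) here      = ⊥-elim (All.lookup h (At-∈ p) refl)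
  At-injective (_ ∷ u) (there p) (there q) = cong suc (At-injective u p q)

  ∈⇒At : ∀ {W : List A} {v} → v ∈ W → ∃ λ a → (a < length W) × At W a v
  ∈⇒At (here refl) = 0 , s≤s z≤n , here
  ∈⇒At (there v∈) with ∈⇒At v∈
  ... | a , a< , at = suc a , s≤s a< , there at

  indices : ∀ {W : List A} w → All (_∈ W) w → ∃ λ φ → (φ ∈ lists (length w) (upTo (length W))) × Pointwise (At W) φ w
  indices []      []       = [] , here refl , []
  indices {W} (v ∷ w) (v∈ ∷ a) with ∈⇒At v∈ | indices {W} w a
  ... | b , b< , at | φ , φ∈ , pw = b ∷ φ , ∈-cartesianProductWith⁺ _∷_ (∈-upTo⁺ b<) φ∈ , at ∷ pw

  Unique-map-injective : ∀ {B : Set} (f : A → B) {xs x y} → Unique (map f xs) → x ∈ xs → y ∈ xs → f x ≡ f y → x ≡ y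
  Unique-map-injective f _       (here refl) (here refl) _  = refl
  Unique-map-injective f (h ∷ _) (here refl) (there y∈)  eq = ⊥-elim (All.lookup h (∈-map⁺ f y∈) eq)
  Unique-map-injective f (h ∷ _) (there x∈)  (here refl) eq = ⊥-elim (All.lookup h (∈-map⁺ f x∈) (sym eq))
  Unique-map-injective f (_ ∷ u) (there x∈)  (there y∈)  eq = Unique-map-injective f u x∈ y∈ eq

  transversal : A → List (List A) → (ℕ → ℕ) → List A
  transversal d []         g = []
  transversal d (Z ∷ rows) g = nth d Z (g 0) ∷ transversal d rows (g ∘ suc)

  transversal-∈ : ∀ d {s rows} (g : ℕ → ℕ) → (∀ a → g a < s) → All (λ Z → Unique Z × length Z ≡ s) rows →
                  Pointwise _∈_ (transversal d rows g) rows
  transversal-∈ d g g< []              = []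
  transversal-∈ d {rows = Z ∷ _} g g< ((_ , len) ∷ h) = nth-∈ d Z (g 0) (subst (g 0 <_) (sym len) (g< 0)) ∷ transversal-∈ d (g ∘ suc) (g< ∘ suc) h

  At-transversal : ∀ {d rows g a v} → At (transversal d rows g) a v → (v ≡ nth d (nth [] rows a) (g a)) × (a < length rows)
  At-transversal {rows = Z ∷ rows} here       = refl , s≤s z≤n
  At-transversal {rows = Z ∷ rows} (there at) with At-transversal {rows = rows} at
  ... | eq , a< = eq , s≤s a<

anyFin⁺ : ∀ {m} (f : Fin m → Bool) i → f i ≡ true → anyFin f ≡ true
anyFin⁺ f fzero    eq rewrite eq = refl
anyFin⁺ f (fsuc i) eq = ≡.trans (cong (f fzero ∨_) (anyFin⁺ (f ∘ fsuc) i eq)) (Boolₚ.∨-zeroʳ (f fzero))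

anyFin⁻ : ∀ {m} (f : Fin m → Bool) → anyFin f ≡ true → ∃ λ i → f i ≡ true
anyFin⁻ {suc m} f eq with f fzero in e
... | true  = fzero , e
... | false with anyFin⁻ (f ∘ fsuc) eq
...   | i , p = fsuc i , p

⌊⌋⁺ : ∀ {P : Set} (d : Dec P) → P → ⌊ d ⌋ ≡ true
⌊⌋⁺ d p = ≡.trans (isYes≗does d) (dec-true d p)

⌊⌋⁻ : ∀ {P : Set} (d : Dec P) → ⌊ d ⌋ ≡ true → P
⌊⌋⁻ (yes p) _ = p

∈-tabulate⁺ : ∀ {n} (f : Fin n → Bool) v → f v ≡ true → v ∈ˢ tabulate f
∈-tabulate⁺ f v eq = lookup⇒[]= v (tabulate f) (≡.trans (lookup∘tabulate f v) eq)

∈-tabulate⁻ : ∀ {n} (f : Fin n → Bool) v → v ∈ˢ tabulate f → f v ≡ true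
∈-tabulate⁻ f v v∈ = ≡.trans (sym (lookup∘tabulate f v)) ([]=⇒lookup v∈)

toℕ-cycShift : ∀ ℓ r (i : Fin (suc ℓ)) (j : Fin r) → toℕ (cycShift (suc ℓ) r i j) ≡ (toℕ i + toℕ j) % suc ℓ
toℕ-cycShift ℓ r i j = toℕ-fromℕ< (m%n<n (toℕ i + toℕ j) (suc ℓ))

positions : ℕ → ℕ → ℕ → List ℕ
positions r ℓ i = applyUpTo (λ k → (i + k) % suc ℓ) r

image-cycWindow : ∀ {n} r ℓ (ψ : ℕ → Fin n) (i : Fin (suc ℓ)) →
                  setOf (map ψ (positions r ℓ (toℕ i))) ≡ image (ψ ∘ toℕ) (cycWindow (suc ℓ) r i)
image-cycWindow {n} r ℓ ψ i = ⊆-antisym to from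
  where
  window : Fin (suc ℓ) → Bool
  window u = anyFin (λ j → ⌊ cycShift (suc ℓ) r i j ≟ᶠ u ⌋)
  hit : Fin n → Fin (suc ℓ) → Bool
  hit v u = lookup (cycWindow (suc ℓ) r i) u ∧ ⌊ ψ (toℕ u) ≟ᶠ v ⌋
  to : ∀ {v} → v ∈ˢ setOf (map ψ (positions r ℓ (toℕ i))) → v ∈ˢ image (ψ ∘ toℕ) (cycWindow (suc ℓ) r i)
  to {v} v∈ with ∈-map⁻ ψ (∈-setOf⁻ (map ψ (positions r ℓ (toℕ i))) v∈)
  ... | j , j∈ , refl with ∈-applyUpTo⁻ (λ k → (toℕ i + k) % suc ℓ) j∈
  ...   | k , k<r , refl = ∈-tabulate⁺ (λ v → anyFin (hit v)) v (anyFin⁺ (hit v) u (cong₂ _∧_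
            (≡.trans (lookup∘tabulate window u) (anyFin⁺ (λ j → ⌊ cycShift (suc ℓ) r i j ≟ᶠ u ⌋) (fromℕ< k<r) (⌊⌋⁺ (u ≟ᶠ u) refl)))
            (⌊⌋⁺ (ψ (toℕ u) ≟ᶠ v) (cong ψ (≡.trans (toℕ-cycShift ℓ r i (fromℕ< k<r)) (cong (λ k → (toℕ i + k) % suc ℓ) (toℕ-fromℕ< k<r)))))))
    where
    u : Fin (suc ℓ)
    u = cycShift (suc ℓ) r i (fromℕ< k<r)
  from : ∀ {v} → v ∈ˢ image (ψ ∘ toℕ) (cycWindow (suc ℓ) r i) → v ∈ˢ setOf (map ψ (positions r ℓ (toℕ i)))
  from {v} v∈ with anyFin⁻ (hit v) (∈-tabulate⁻ (λ v → anyFin (hit v)) v v∈)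
  ... | u , eq with lookup (cycWindow (suc ℓ) r i) u in eq₁
  ...   | true with anyFin⁻ (λ j → ⌊ cycShift (suc ℓ) r i j ≟ᶠ u ⌋) (≡.trans (sym (lookup∘tabulate window u)) eq₁)
  ...     | j , eq₂ = ∈-setOf⁺ (subst (_∈ map ψ (positions r ℓ (toℕ i))) (≡.trans (cong ψ (sym u≡)) (⌊⌋⁻ (ψ (toℕ u) ≟ᶠ v) eq))
                         (∈-map⁺ ψ (∈-applyUpTo⁺ (λ k → (toℕ i + k) % suc ℓ) (toℕ<n j))))
    where
    u≡ : toℕ u ≡ (toℕ i + toℕ j) % suc ℓ
    u≡ = ≡.trans (cong toℕ (sym (⌊⌋⁻ (cycShift (suc ℓ) r i j ≟ᶠ u) eq₂))) (toℕ-cycShift ℓ r i j)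

module _ {n : ℕ} (H : Hypergraph n) (r ℓ : ℕ) where

  open World H r

  -- φ lists the positions in W of the successive vertices of a closed walk.
  Shape : List ℕ → List (Fin n) → Set
  Shape φ W = Unique W × ∃ λ w → Pointwise (At W) φ w × CyclicWord r E (suc ℓ) w

  cyclic? : ∀ w → Dec (CyclicWord r E (suc ℓ) w)
  cyclic? w = (length w ℕ.≟ suc ℓ) ×-dec map′ (λ h i → h {i}) (λ h {i} → h i) (allUpTo? (λ i → E? (take r (drop i (w ++ w)))) (suc ℓ))

  -- The double negation is removed here: the words of the given length over `W` are finitely many
  -- and being cyclic is decidable.
  shape-of-word : ∀ {W} → Unique W → ¬ ¬ (∃ λ w → CyclicWord r E (suc ℓ) w × All (_∈ W) w) →
                  Any (λ φ → Shape φ W) (lists (suc ℓ) (upTo (length W)))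
  shape-of-word {W} u nn with decidable-stable (any? cyclic? (lists (suc ℓ) W)) (λ none → nn (λ { (w , cyc , w⊆) →
        none (lose (subst (λ k → w ∈ lists k W) (proj₁ cyc) (∈-lists w w⊆)) cyc) }))
  ... | found with find found
  ...   | w , w∈ , cyc with indices w (lists-⊆ (suc ℓ) w∈)
    where
    lists-⊆ : ∀ k {L} → L ∈ lists k W → All (_∈ W) L
    lists-⊆ zero    (here refl) = []
    lists-⊆ (suc k) L∈ with ∈-cartesianProductWith⁻ _∷_ W (lists k W) L∈
    ... | _ , _ , u∈ , L∈′ , refl = u∈ ∷ lists-⊆ k L∈′
  ...     | φ , φ∈ , pw = lose (subst (λ k → φ ∈ lists k (upTo (length W))) (proj₁ cyc) φ∈) (u , w , pw , cyc)

  module _ (d : Fin n) (r≤ℓ : r ≤ suc ℓ) (φ : List ℕ) {M : ℕ} (box : Box (suc ℓ) M (Shape φ)) where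

    private
      rows : List (List (Fin n))
      rows = proj₁ box
      rows-ok : All (λ Z → Unique Z × length Z ≡ suc ℓ) rows
      rows-ok = proj₁ (proj₂ (proj₂ box))

    vertex : ℕ → ℕ → Fin n
    vertex a j = nth d (nth [] rows a) j

    class : ℕ → ℕ
    class = nth 0 φ

    -- The j-th vertex of the cycle is the j-th copy of its class, so all of them are distinct.
    ψ : ℕ → Fin n
    ψ j = vertex (class j) j

    module Choice (g : ℕ → ℕ) (g< : ∀ a → g a < suc ℓ) where

      l : List (Fin n)
      l = transversal d rows g

      private
        shape : Shape φ l
        shape = proj₂ (proj₂ (proj₂ box)) l (transversal-∈ d g g< rows-ok)
        w : List (Fin n)
        w = proj₁ (proj₂ shape)
        length-w : length w ≡ suc ℓ
        length-w = proj₁ (proj₂ (proj₂ (proj₂ shape)))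

      l-unique : Unique l
      l-unique = proj₁ shape

      f : ℕ → Fin n
      f j = vertex (class j) (g (class j))

      private
        at-word : ∀ j → j < suc ℓ → At l (class j) (nth d w j)
        at-word j j< = pointwise-nth (proj₁ (proj₂ (proj₂ shape))) j (subst (j <_) (sym (≡.trans (Pointwise-length (proj₁ (proj₂ (proj₂ shape)))) length-w)) j<)

        word-value : ∀ j → j < suc ℓ → nth d w j ≡ f j
        word-value j j< = proj₁ (At-transversal {rows = rows} (at-word j j<))

      class< : ∀ j → j < suc ℓ → class j < length rows
      class< j j< = proj₂ (At-transversal {rows = rows} (at-word j j<))

      at : ∀ j → j < suc ℓ → At l (class j) (f j)
      at j j< = subst (At l (class j)) (word-value j j<) (at-word j j<)

      window-edge : ∀ i → i < suc ℓ → E (map f (positions r ℓ i))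
      window-edge i i< = subst E (begin
        take r (drop i (w ++ w))                         ≡⟨ window-nth d r i (w ++ w) fits ⟩
        applyUpTo (λ k → nth d (w ++ w) (i + k)) r       ≡⟨ applyUpTo-cong r step ⟩
        applyUpTo (λ k → f ((i + k) % suc ℓ)) r          ≡⟨ sym (map-applyUpTo f (λ k → (i + k) % suc ℓ) r) ⟩
        map f (positions r ℓ i)                          ∎) (proj₂ (proj₂ (proj₂ (proj₂ shape))) i i<)
        where
        open ≡-Reasoning
        length-ww : length (w ++ w) ≡ suc ℓ + suc ℓ
        length-ww = ≡.trans (length-++ w) (cong₂ _+_ length-w length-w)
        fits : i + r ≤ length (w ++ w)
        fits = ≤-trans (+-mono-≤ (<⇒≤ i<) r≤ℓ) (≤-reflexive (sym length-ww))
        step : ∀ k → k < r → nth d (w ++ w) (i + k) ≡ f ((i + k) % suc ℓ)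
        step k k<r = ≡.trans (nth-double d w (suc ℓ) (i + k) length-w (+-mono-<-≤ i< (≤-trans (<⇒≤ k<r) r≤ℓ)))
                             (word-value ((i + k) % suc ℓ) (m%n<n (i + k) (suc ℓ)))

    -- Within a row, different indices select different entries. For different rows, the transversal
    -- that takes index `j` in the row of `j` and index `j′` elsewhere contains both vertices, at
    -- different positions, and transversals have no repetitions.
    ψ-injective : ∀ j j′ → j < suc ℓ → j′ < suc ℓ → ψ j ≡ ψ j′ → j ≡ j′
    ψ-injective j j′ j< j′< eq with class j ℕ.≟ class j′
    ... | yes same = nth-injective {d = d} (proj₁ row-ok) j j′ (subst (j <_) (sym (proj₂ row-ok)) j<) (subst (j′ <_) (sym (proj₂ row-ok)) j′<)
                       (≡.trans eq (cong (λ a → vertex a j′) (sym same)))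
      where
      open Choice (λ _ → 0) (λ _ → s≤s z≤n)
      row-ok : Unique (nth [] rows (class j)) × length (nth [] rows (class j)) ≡ suc ℓ
      row-ok = nth-All rows-ok (class j) (class< j j<)
    ... | no differ = ⊥-elim (differ (At-injective l-unique (subst (At l (class j)) fj (at j j<))
                                       (subst (At l (class j′)) (≡.trans fj′ (sym eq)) (at j′ j′<))))
      where
      g : ℕ → ℕ
      g a with a ℕ.≟ class j
      ... | yes _ = j
      ... | no _  = j′
      g< : ∀ a → g a < suc ℓ
      g< a with a ℕ.≟ class j
      ... | yes _ = j<
      ... | no _  = j′<
      open Choice g g<
      fj : f j ≡ ψ j
      fj with class j ℕ.≟ class j
      ... | yes _ = refl
      ... | no n  = ⊥-elim (n refl)
      fj′ : f j′ ≡ ψ j′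
      fj′ with class j′ ℕ.≟ class j
      ... | yes e = ⊥-elim (differ (sym e))
      ... | no _  = refl

    -- A window is an edge for every transversal, so its vertices are distinct and no two of its
    -- positions share a class. Hence one transversal can use, for each class met by the window, the
    -- index of the position with that class, and then agrees with ψ on the whole window.
    ψ-edge : ∀ i → i < suc ℓ → E (map ψ (positions r ℓ i))
    ψ-edge i i< = subst E (map-cong-local (All.tabulate agree)) (window-edge i i<)
      where
      pos : List ℕ
      pos = positions r ℓ i
      pos< : ∀ {j} → j ∈ pos → j < suc ℓ
      pos< j∈ with ∈-applyUpTo⁻ (λ k → (i + k) % suc ℓ) j∈
      ... | k , _ , refl = m%n<n (i + k) (suc ℓ)
      search : ∀ a → Dec (Any (λ j → class j ≡ a) pos)
      search a = any? (λ j → class j ℕ.≟ a) pos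
      pick : ∀ {a} → Dec (Any (λ j → class j ≡ a) pos) → ℕ
      pick (yes p) = proj₁ (find p)
      pick (no _)  = 0
      pick< : ∀ {a} (s : Dec (Any (λ j → class j ≡ a) pos)) → pick s < suc ℓ
      pick< (yes p) = pos< (proj₁ (proj₂ (find p)))
      pick< (no _)  = s≤s z≤n
      g : ℕ → ℕ
      g a = pick (search a)
      open Choice g (λ a → pick< (search a))
      g-class : ∀ {j} → j ∈ pos → g (class j) ≡ j
      g-class {j} j∈ = found (search (class j))
        where
        found : (s : Dec (Any (λ j′ → class j′ ≡ class j) pos)) → pick s ≡ j
        found (yes p) = Unique-map-injective f (E-unique (window-edge i i<)) (proj₁ (proj₂ (find p))) j∈
                          (cong (λ a → vertex a (g a)) (proj₂ (proj₂ (find p))))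
        found (no n)  = ⊥-elim (n (lose j∈ refl))
      agree : ∀ {j} → j ∈ pos → f j ≡ ψ j
      agree {j} j∈ = cong (vertex (class j)) (g-class j∈)

    box⇒Contains : Contains H (TightCycle r (suc ℓ))
    box⇒Contains = ψ ∘ toℕ , (λ {a} {b} eq → toℕ-injective (ψ-injective (toℕ a) (toℕ b) (toℕ<n a) (toℕ<n b) eq)) , edges
      where
      edges : ∀ e → edge (TightCycle r (suc ℓ)) e ≡ true → edge H (image (ψ ∘ toℕ) e) ≡ true
      edges e eq with anyFin⁻ (λ i → ⌊ Vec-≡-dec Boolₚ._≟_ (cycWindow (suc ℓ) r i) e ⌋) eq
      ... | i , eq′ with ⌊⌋⁻ (Vec-≡-dec Boolₚ._≟_ (cycWindow (suc ℓ) r i) e) eq′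
      ...   | refl = ≡.trans (cong (edge H) (sym (image-cycWindow r ℓ ψ i))) (proj₂ (proj₂ (ψ-edge (toℕ i) (toℕ<n i))))

-- Assembling the bound

density-bound : ∀ r q d k p m ℓ → 1 ≤ r → r ≡ d * q → q ≡ suc (p * 2) → k ≤ q → worldSize r ^ r < m → suc ℓ ≡ m * r + k * d →
                CodegDensityAtMostThird r (TightCycle r (suc ℓ))
density-bound r q d k p m ℓ 1≤r r≡ q≡ k≤q m> ℓ≡ t 1≤t = N , bound
  where
  M C₁ N₁ N : ℕ
  M = worldSize r
  -- Fixing one shape for the tuples costs a factor of two for each possible shape, a list of ℓ + 1
  -- positions below M.
  C₁ = 2 * t * 2 ^ length (lists (suc ℓ) (upTo M))
  N₁ = proj₁ (Ample⇒Box C₁ M (suc ℓ))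
  -- N₁ is for the box and 2 t M for avoiding used vertices; the successor makes n positive.
  N = suc (N₁ + 2 * t * M)
  r≤ℓ : r ≤ suc ℓ
  r≤ℓ = ≤-trans (m≤n*m r m {{ℕ.>-nonZero (≤-trans (s≤s z≤n) m>)}}) (≤-trans (m≤m+n (m * r) (k * d)) (≤-reflexive (sym ℓ≡)))
  contains : ∀ n → N ≤ n → (H : Hypergraph n) → (∀ S → ∣ S ∣ + 1 ≡ r → ¬ (codeg H S * (3 * t) ≤ (t + 3) * n)) →
             Contains H (TightCycle r (suc ℓ))
  contains (suc n) (s≤s N≤n) H codegree = embed (Any.satisfied (Ample-any {C = 2 * t} M (Shape H r ℓ) (lists (suc ℓ) (upTo M)) (s≤s z≤n) shapes))
    where
    open World H r
    open Build t 1≤t codegree M (≤-trans (m≤n+m (2 * t * M) N₁) (m≤n⇒m≤1+n N≤n))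
    shapes : Ample (2 * t) M (λ W → Any (λ φ → Shape H r ℓ φ W) (lists (suc ℓ) (upTo M)))
    shapes = Ample-map M (λ { W len (ws , adm , X , ch , cl , X⊆W , u) →
        subst (λ k → Any (λ φ → Shape H r ℓ φ W) (lists (suc ℓ) (upTo k))) len
          (shape-of-word H r ℓ u (subst (λ j → ¬ ¬ (∃ λ w → CyclicWord r E j w × All (_∈ W) w)) (sym ℓ≡)
            (closed-walk H r {p = p} 1≤r r≡ q≡ k≤q ch adm cl X⊆W (subst (λ k → k ^ r < m) (sym len) m>)))) })
      (world 1≤r ≤-refl)
    embed : (∃ λ φ → Ample C₁ M (Shape H r ℓ φ)) → Contains H (TightCycle r (suc ℓ))
    embed (φ , amp) = box⇒Contains H r ℓ fzero r≤ℓ φ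
      (proj₂ (Ample⇒Box C₁ M (suc ℓ)) (Shape H r ℓ φ) (s≤s z≤n) (≤-trans (m≤m+n N₁ _) (m≤n⇒m≤1+n N≤n)) (Ample-weaken M (n≤1+n C₁) amp))
  bound : ∀ n → N ≤ n → (H : Hypergraph n) → Uniform r H → (Contains H (TightCycle r (suc ℓ)) → ⊥) →
          MinCodegScaledLe r H (3 * t) ((t + 3) * n)
  bound n N≤n H _ free with anySubset? (λ S → (∣ S ∣ + 1 ℕ.≟ r) ×-dec (codeg H S * (3 * t) ≤? (t + 3) * n))
  ... | yes found = found
  ... | no none   = ⊥-elim (free (contains n N≤n H (λ S eq le → none (S , eq , le))))

theorem1 : (r k : ℕ) → 2 ≤ r → modℕ k r ≢ 0 → ¬ (2 ∣ ratioGcd r k) →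
    ∃ λ L → (ℓ : ℕ) → L < ℓ → modℕ ℓ r ≡ modℕ k r →
    CodegDensityAtMostThird r (TightCycle r ℓ)
theorem1 r@(suc r′) k 2≤r _ odd = suc (worldSize r ^ r) * r , cycle
  where
  instance
    gcd-nonZero : NonZero (gcd r k)
    gcd-nonZero = ≢-nonZero (gcd[m,n]≢0 r k (inj₁ (λ ())))
  d q : ℕ
  d = gcd r k
  q = r / d
  r≡ : r ≡ d * q
  r≡ = ≡.trans (sym (m/n*n≡m (gcd[m,n]∣m r k))) (*-comm q d)
  -- Above this bound the quotient ℓ / r exceeds `worldSize r ^ r`, the number of lists of r chosen
  -- vertices. The quotient becomes the number of moves of the walk, and the residue s d its
  -- rotation by s blocks.
  cycle : ∀ ℓ → suc (worldSize r ^ r) * r < ℓ → ℓ % r ≡ k % r → CodegDensityAtMostThird r (TightCycle r ℓ)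
  cycle (suc ℓ) L<ℓ ℓ≡k with even-or-odd q | %-presˡ-∣ {n = r} (gcd[m,n]∣n r k) (gcd[m,n]∣m r k)
  ... | j , inj₁ q≡ | _ = ⊥-elim (odd (divides j q≡))
  ... | p , inj₂ q≡ | divides s s≡ = density-bound r q d s p (suc ℓ / r) ℓ (s≤s z≤n) r≡ q≡ s≤q m> ℓ≡
    where
    s≤q : s ≤ q
    s≤q = *-cancelʳ-≤ s q d (subst₂ _≤_ s≡ (≡.trans r≡ (*-comm d q)) (<⇒≤ (m%n<n k r)))
    m> : worldSize r ^ r < suc ℓ / r
    m> = ≤-trans (≤-reflexive (sym (m*n/n≡m (suc (worldSize r ^ r)) r))) (/-monoˡ-≤ r (<⇒≤ L<ℓ))
    ℓ≡ : suc ℓ ≡ suc ℓ / r * r + s * d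
    ℓ≡ = ≡.trans (m≡m%n+[m/n]*n (suc ℓ) r) (≡.trans (+-comm (suc ℓ % r) _) (cong (suc ℓ / r * r +_) (≡.trans ℓ≡k s≡)))
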